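{- Let $\mathbf{k}$ be a commutative ring, let $k\in\mathbb{N}$, and let $n\geq k$ be an integer. Let $\mathcal{P}=\mathbf{k}[x_1,x_2,\ldots,x_k]$. For each $i\in\{1,2,\ldots,k\}$, let $a_i\in\mathcal{P}$ be a (not necessarily homogeneous) polynomial of degree $<n-k+i$. Let $J$ be the ideal of $\mathcal{P}$ generated by the $k$ differences $h_{n-k+1}-a_1,\ h_{n-k+2}-a_2,\ \ldots,\ h_n-a_k$. Then the $\mathbf{k}$-module $\mathcal{P}/J$ is free with basis $\left(\overline{x^\alpha}\right)_{\alpha\in\mathbb{N}^k;\ \alpha_i<n-k+i\text{ for each }i}$, where $\overline{x^\alpha}$ denotes the residue class of $x^\alpha$ modulo $J$.
   Context: $\mathbb{N}=\{0,1,2,\ldots\}$. The degree of a polynomial is its total degree (each $x_i$ has degree $1$); the zero polynomial counts as having degree smaller than every integer. For $\alpha=(\alpha_1,\ldots,\alpha_k)\in\mathbb{N}^k$, $x^\alpha=x_1^{\alpha_1}x_2^{\alpha_2}\cdots x_k^{\alpha_k}$ and $|\alpha|=\alpha_1+\cdots+\alpha_k$. For $m\in\mathbb{Z}$, $h_m=\sum_{\alpha\in\mathbb{N}^k,\ |\alpha|=m}x^\alpha\in\mathcal{P}$ is the $m$-th complete homogeneous symmetric polynomial in $x_1,\ldots,x_k$ (so $h_0=1$ and $h_m=0$ for $m<0$). -}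

module Defs where

open import Algebra.Bundles using (CommutativeRing)
open import Algebra.Module.Bundles using (Module)
open import Algebra.Module.Structures.Biased using (IsModuleFromLeft)
open import Algebra.Morphism.Structures using (module RingMorphisms)
import Algebra.Properties.CommutativeSemigroup as CommutativeSemigroupProperties
import Algebra.Properties.CommutativeMonoid.Sum as Sum
import Algebra.Properties.Ring as RingProperties
import Algebra.Properties.Semiring.Sum as SemiringSum
open import Data.Bool.Base using (if_then_else_)
open import Data.List.Base as List using (List; []; _∷_; _++_; concatMap; filter; length; upTo)
open import Data.List.Membership.Propositional using (_∈_; find; lose)
open import Data.List.Membership.Propositional.Properties using (∈-map⁺; ∈-map⁻; ∈-concatMap⁺; ∈-concatMap⁻; ∈-upTo⁺; ∈-upTo⁻)
open import Data.List.Properties using (length-filter)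
open import Data.List.Relation.Unary.All as All using (All)
open import Data.List.Relation.Unary.AllPairs as AllPairs using ([]; _∷_)
open import Data.List.Relation.Unary.Any using (here; there)
open import Data.List.Relation.Unary.Unique.Propositional using (Unique)
import Data.List.Relation.Unary.AllPairs.Properties as AllPairs
import Data.List.Relation.Unary.All.Properties as All
import Data.List.Relation.Unary.Unique.Propositional.Properties as Unique
open import Data.Nat.Base as ℕ using (ℕ; zero; suc; _∸_; s≤s)
import Data.Nat.Properties as ℕ
open import Data.Product.Base using (Σ; ∃-syntax; _×_; _,_)
open import Data.Vec.Base as Vec using (Vec; []; _∷_; zipWith; replicate)
open import Data.Vec.Functional using (Vector)
import Data.Vec.Properties as Vec
open import Function.Base using (_∘_; id)
open import Function.Definitions using (Injective)
open import Level using (Level; _⊔_)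
import Level
open import Relation.Binary.PropositionalEquality.Core as ≡ using (_≡_; _≢_)
open import Relation.Nullary using (¬_; yes; no; does; ¬?; contradiction; Dec)

private
  variable
    c ℓ c′ ℓ′ m ℓm : Level

module _ {R : CommutativeRing c ℓ} (M : Module R m ℓm) where
  open CommutativeRing R using (Carrier; _≈_; 0#)
  open Module M using (Carrierᴹ; _≈ᴹ_; _*ₗ_; 0ᴹ; +ᴹ-commutativeMonoid)
  open Sum +ᴹ-commutativeMonoid using (sum)

  linearCombination : ∀ {s} → Vector Carrier s → Vector Carrierᴹ s → Carrierᴹ
  linearCombination r v = sum (λ j → r j *ₗ v j)

  record IsBasis {i} {I : Set i} (b : I → Carrierᴹ) : Set (c ⊔ ℓ ⊔ m ⊔ ℓm ⊔ i) where
    field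
      spanning    : ∀ v → ∃[ s ] Σ (Vector Carrier s) λ r → Σ (Vector I s) λ ι →
                    v ≈ᴹ linearCombination r (b ∘ ι)
      independent : ∀ {s} (r : Vector Carrier s) (ι : Vector I s) → Injective _≡_ _≡_ ι →
                    linearCombination r (b ∘ ι) ≈ᴹ 0ᴹ → ∀ j → r j ≈ 0#

record Ideal (A : CommutativeRing c ℓ) p : Set (c ⊔ ℓ ⊔ Level.suc p) where
  open CommutativeRing A
  field
    Member   : Carrier → Set p
    resp     : ∀ {x y} → x ≈ y → Member x → Member y
    0-closed : Member 0#
    +-closed : ∀ {x y} → Member x → Member y → Member (x + y)
    *-closed : ∀ x {y} → Member y → Member (x * y)

module _ (A : CommutativeRing c ℓ) where
  open CommutativeRing A
  open SemiringSum semiring using (sum; sum-cong-≋; ∑-distrib-+; *-distribˡ-sum; sum-replicate-zero)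

  generatedIdeal : ∀ {s} → Vector Carrier s → Ideal A (c ⊔ ℓ)
  generatedIdeal {s} g = record
    { Member   = λ x → Σ (Vector Carrier s) λ q → x ≈ sum (λ i → q i * g i)
    ; resp     = λ { x≈y (q , e) → q , trans (sym x≈y) e }
    ; 0-closed = (λ _ → 0#) ,
                 sym (trans (sum-cong-≋ (λ i → zeroˡ (g i))) (sum-replicate-zero s))
    ; +-closed = λ { (q , e) (q′ , e′) → (λ i → q i + q′ i) ,
                 trans (+-cong e e′)
                 (trans (sym (∑-distrib-+ (λ i → q i * g i) (λ i → q′ i * g i)))
                        (sum-cong-≋ (λ i → sym (distribʳ (g i) (q i) (q′ i))))) }
    ; *-closed = λ { x (q , e) → (λ i → x * q i) ,
                 trans (*-congˡ e)
                 (trans (*-distribˡ-sum x (λ i → q i * g i))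
                        (sum-cong-≋ (λ i → sym (*-assoc x (q i) (g i))))) }
    }

module Quotient (A : CommutativeRing c ℓ) {p} (I : Ideal A p) where
  open CommutativeRing A
  open Ideal I
  open RingProperties ring using (-1*x≈-x; -‿distribʳ-*; -‿+-comm; ⁻¹-anti-homo-//)
  open CommutativeSemigroupProperties +-commutativeSemigroup using (interchange)

  infix 4 _≈/_
  record _≈/_ (x y : Carrier) : Set p where
    constructor congruent
    field difference : Member (x - y)
  open _≈/_ public

  private
    neg-closed : ∀ {x} → Member x → Member (- x)
    neg-closed {x} x∈I = resp (-1*x≈-x x) (*-closed (- 1#) x∈I)

  ≈⇒≈/ : ∀ {x y} → x ≈ y → x ≈/ y
  ≈⇒≈/ {x} {y} x≈y = congruent (resp (sym (trans (+-congʳ x≈y) (-‿inverseʳ y))) 0-closed)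

  sym/ : ∀ {x y} → x ≈/ y → y ≈/ x
  sym/ {x} {y} (congruent d) = congruent (resp (⁻¹-anti-homo-// x y) (neg-closed d))

  +-cong/ : ∀ {x y u v} → x ≈/ y → u ≈/ v → (x + u) ≈/ (y + v)
  +-cong/ {x} {y} {u} {v} (congruent d) (congruent e) = congruent
    (resp (trans (interchange x (- y) u (- v)) (+-congˡ (-‿+-comm y v))) (+-closed d e))

  trans/ : ∀ {x y z} → x ≈/ y → y ≈/ z → x ≈/ z
  trans/ {x} {y} {z} (congruent d) (congruent e) = congruent (resp eq (+-closed d e))
    where
    eq : (x - y) + (y - z) ≈ x - z
    eq = trans (+-assoc x (- y) (y - z))
         (+-congˡ (trans (sym (+-assoc (- y) y (- z)))
                  (trans (+-congʳ (-‿inverseˡ y)) (+-identityˡ (- z)))))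

  *-congˡ/ : ∀ x {u v} → u ≈/ v → (x * u) ≈/ (x * v)
  *-congˡ/ x {u} {v} (congruent d) = congruent
    (resp (trans (distribˡ x u (- v)) (+-congˡ (sym (-‿distribʳ-* x v)))) (*-closed x d))

  -‿cong/ : ∀ {x y} → x ≈/ y → (- x) ≈/ (- y)
  -‿cong/ {x} {y} d =
    trans/ (≈⇒≈/ (sym (-1*x≈-x x))) (trans/ (*-congˡ/ (- 1#) d) (≈⇒≈/ (-1*x≈-x y)))

  -- The residue class of x is represented by x itself; only the equality
  -- changes.
  residue : Carrier → Carrier
  residue = id

  -- A / I, as a module over R through a ring homomorphism R → A.
  module _ (R : CommutativeRing c′ ℓ′) {φ : CommutativeRing.Carrier R → Carrier}
           (φ-hom : RingMorphisms.IsRingHomomorphism (CommutativeRing.rawRing R) rawRing φ) where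
    private
      module φ = RingMorphisms.IsRingHomomorphism φ-hom

    quotientModule : Module R c p
    quotientModule = record
      { Carrierᴹ = Carrier
      ; _≈ᴹ_     = _≈/_
      ; _+ᴹ_     = _+_
      ; _*ₗ_     = λ r x → φ r * x
      ; _*ᵣ_     = λ x r → φ r * x
      ; 0ᴹ       = 0#
      ; -ᴹ_      = -_
      ; isModule = IsModuleFromLeft.isModule {commutativeRing = R} (record
        { isLeftModule = record
          { isLeftSemimodule = record
            { +ᴹ-isCommutativeMonoid = record
              { isMonoid = record
                { isSemigroup = record
                  { isMagma = record
                    { isEquivalence = record { refl = ≈⇒≈/ refl ; sym = sym/ ; trans = trans/ }
                    ; ∙-cong        = +-cong/
                    }
                  ; assoc = λ x y z → ≈⇒≈/ (+-assoc x y z)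
                  }
                ; identity = (λ x → ≈⇒≈/ (+-identityˡ x)) , (λ x → ≈⇒≈/ (+-identityʳ x))
                }
              ; comm = λ x y → ≈⇒≈/ (+-comm x y)
              }
            ; isPreleftSemimodule = record
              { *ₗ-cong      = λ {_} {s} r≈s x≈y →
                  trans/ (≈⇒≈/ (*-congʳ (φ.⟦⟧-cong r≈s))) (*-congˡ/ (φ s) x≈y)
              ; *ₗ-zeroˡ     = λ x → ≈⇒≈/ (trans (*-congʳ φ.0#-homo) (zeroˡ x))
              ; *ₗ-distribʳ  = λ x r s →
                  ≈⇒≈/ (trans (*-congʳ (φ.+-homo r s)) (distribʳ x (φ r) (φ s)))
              ; *ₗ-identityˡ = λ x → ≈⇒≈/ (trans (*-congʳ φ.1#-homo) (*-identityˡ x))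
              ; *ₗ-assoc     = λ r s x →
                  ≈⇒≈/ (trans (*-congʳ (φ.*-homo r s)) (*-assoc (φ r) (φ s) x))
              ; *ₗ-zeroʳ     = λ r → ≈⇒≈/ (zeroʳ (φ r))
              ; *ₗ-distribˡ  = λ r x y → ≈⇒≈/ (distribˡ (φ r) x y)
              }
            }
          ; -ᴹ‿cong    = -‿cong/
          ; -ᴹ‿inverse = (λ x → ≈⇒≈/ (-‿inverseˡ x)) , (λ x → ≈⇒≈/ (-‿inverseʳ x))
          }
        })
      }

∣_∣ : ∀ {k} → Vec ℕ k → ℕ
∣_∣ = Vec.sum

multiIndices : ∀ k → ℕ → List (Vec ℕ k)
multiIndices zero    zero    = [] ∷ []
multiIndices zero    (suc _) = []
multiIndices (suc k) m       = concatMap (λ j → List.map (j ∷_) (multiIndices k (m ∸ j))) (upTo (suc m))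

-- multiIndices k m lists each α ∈ ℕᵏ with |α| = m exactly once.
∈-multiIndices⁺ : ∀ {k} (α : Vec ℕ k) → α ∈ multiIndices k ∣ α ∣
∈-multiIndices⁺ []      = here ≡.refl
∈-multiIndices⁺ (j ∷ α) = ∈-concatMap⁺ (λ i → List.map (i ∷_) (multiIndices _ (j ℕ.+ ∣ α ∣ ∸ i)))
  (lose (∈-upTo⁺ (s≤s (ℕ.m≤m+n j ∣ α ∣)))
        (∈-map⁺ (j ∷_) (≡.subst (λ s → α ∈ multiIndices _ s) (≡.sym (ℕ.m+n∸m≡n j ∣ α ∣))
                                (∈-multiIndices⁺ α))))

∈-multiIndices⁻ : ∀ {k} m {α : Vec ℕ k} → α ∈ multiIndices k m → ∣ α ∣ ≡ m
∈-multiIndices⁻ {zero}  zero {[]} _ = ≡.refl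
∈-multiIndices⁻ {suc k} m α∈
  with find (∈-concatMap⁻ (λ i → List.map (i ∷_) (multiIndices k (m ∸ i))) {xs = upTo (suc m)} α∈)
... | j , j∈ , α∈′ with ∈-map⁻ (j ∷_) α∈′
... | β , β∈ , ≡.refl = ≡.trans (≡.cong (j ℕ.+_) (∈-multiIndices⁻ (m ∸ j) β∈))
                                (ℕ.m+[n∸m]≡n (ℕ.≤-pred (∈-upTo⁻ j∈)))

multiIndices-unique : ∀ k m → Unique (multiIndices k m)
multiIndices-unique zero    zero    = All.[] ∷ []
multiIndices-unique zero    (suc _) = []
multiIndices-unique (suc k) m       = Unique.concat⁺
  (All.map⁺ (All.universal (λ j → Unique.map⁺ Vec.∷-injectiveʳ (multiIndices-unique k (m ∸ j))) _))
  (AllPairs.map⁺ (AllPairs.map disjoint (Unique.upTo⁺ (suc m))))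
  where
  disjoint : ∀ {i j} → i ≢ j → ∀ {v} →
             ¬ (v ∈ List.map (i ∷_) (multiIndices k (m ∸ i)) × v ∈ List.map (j ∷_) (multiIndices k (m ∸ j)))
  disjoint i≢j (v∈ᵢ , v∈ⱼ) with ∈-map⁻ _ v∈ᵢ | ∈-map⁻ _ v∈ⱼ
  ... | _ , _ , ≡.refl | _ , _ , e = i≢j (Vec.∷-injectiveˡ e)

module Polynomial (R : CommutativeRing c ℓ) (k : ℕ) where
  open CommutativeRing R renaming (Carrier to K)
  open RingProperties ring using (-‿distribˡ-*; -‿+-comm; -0#≈0#; x∙y⁻¹≈ε⇒x≈y)
  open CommutativeSemigroupProperties +-commutativeSemigroup using (interchange)
  open CommutativeSemigroupProperties *-commutativeSemigroup using () renaming (x∙yz≈y∙xz to x*yz≈y*xz)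
  open import Relation.Binary.Reasoning.Setoid setoid

  Exponent : Set
  Exponent = Vec ℕ k

  -- (r₁ , α₁) ∷ … ∷ (rₛ , αₛ) ∷ [] stands for r₁ x^α₁ + … + rₛ x^αₛ; the
  -- exponents may repeat and the coefficients may vanish, so polynomials are
  -- compared by the coefficients they give to each monomial.
  Poly : Set c
  Poly = List (K × Exponent)

  _≟_ : (α β : Exponent) → Dec (α ≡ β)
  _≟_ = Vec.≡-dec ℕ._≟_

  coeff : Poly → Exponent → K
  coeff []            α = 0#
  coeff ((r , β) ∷ p) α = if does (β ≟ α) then r + coeff p α else coeff p α

  infix 4 _≈ᴾ_
  record _≈ᴾ_ (p q : Poly) : Set ℓ where
    constructor coefficientwise
    field coeff-≈ : ∀ α → coeff p α ≈ coeff q α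
  open _≈ᴾ_ public

  infixl 6 _+ᵉ_
  _+ᵉ_ : Exponent → Exponent → Exponent
  _+ᵉ_ = zipWith ℕ._+_

  0ᵉ : Exponent
  0ᵉ = replicate k 0

  monomial : Exponent → Poly
  monomial α = (1# , α) ∷ []

  constant : K → Poly
  constant r = (r , 0ᵉ) ∷ []

  infixl 6 _+ᴾ_
  infixl 7 _*ᴾ_
  infix  8 -ᴾ_

  0ᴾ 1ᴾ : Poly
  0ᴾ = []
  1ᴾ = constant 1#

  _+ᴾ_ _*ᴾ_ : Poly → Poly → Poly
  p +ᴾ q = p ++ q
  p *ᴾ q = concatMap (λ (r , α) → List.map (λ (s , β) → r * s , α +ᵉ β) q) p

  -ᴾ_ : Poly → Poly
  -ᴾ p = List.map (λ (r , α) → - r , α) p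

  -- eval f is the linear functional sending x^α to f α; p ≈ᴾ q if and only if
  -- all these functionals agree on p and q, which yields the ring laws.
  eval : (Exponent → K) → Poly → K
  eval f []            = 0#
  eval f ((r , α) ∷ p) = r * f α + eval f p

  δ : Exponent → Exponent → K
  δ α β = if does (β ≟ α) then 1# else 0#

  coeff-eval : ∀ p α → coeff p α ≈ eval (δ α) p
  coeff-eval []            α = refl
  coeff-eval ((r , β) ∷ p) α with β ≟ α
  ... | yes _ = +-cong (sym (*-identityʳ r)) (coeff-eval p α)
  ... | no  _ = trans (coeff-eval p α) (sym (trans (+-congʳ (zeroʳ r)) (+-identityˡ _)))

  eval-cong : ∀ {f g} p → (∀ α → f α ≈ g α) → eval f p ≈ eval g p
  eval-cong []            f≈g = refl
  eval-cong ((r , α) ∷ p) f≈g = +-cong (*-congˡ (f≈g α)) (eval-cong p f≈g)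

  eval-++ : ∀ f p q → eval f (p +ᴾ q) ≈ eval f p + eval f q
  eval-++ f []            q = sym (+-identityˡ _)
  eval-++ f ((r , α) ∷ p) q = trans (+-congˡ (eval-++ f p q)) (sym (+-assoc _ _ _))

  eval-neg : ∀ f p → eval f (-ᴾ p) ≈ - eval f p
  eval-neg f []            = sym -0#≈0#
  eval-neg f ((r , α) ∷ p) =
    trans (+-cong (sym (-‿distribˡ-* r (f α))) (eval-neg f p)) (-‿+-comm _ _)

  eval-0 : ∀ p → eval (λ _ → 0#) p ≈ 0#
  eval-0 []            = refl
  eval-0 ((r , α) ∷ p) = trans (+-cong (zeroʳ r) (eval-0 p)) (+-identityˡ 0#)

  eval-+ : ∀ f g p → eval (λ α → f α + g α) p ≈ eval f p + eval g p
  eval-+ f g []            = sym (+-identityˡ 0#)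
  eval-+ f g ((r , α) ∷ p) =
    trans (+-cong (distribˡ r (f α) (g α)) (eval-+ f g p)) (interchange _ _ _ _)

  eval-scale : ∀ s f p → eval (λ α → s * f α) p ≈ s * eval f p
  eval-scale s f []            = sym (zeroʳ s)
  eval-scale s f ((r , α) ∷ p) =
    trans (+-cong (x*yz≈y*xz r s (f α)) (eval-scale s f p)) (sym (distribˡ s _ _))

  eval-comm : ∀ (F : Exponent → Exponent → K) p q →
              eval (λ α → eval (F α) q) p ≈ eval (λ β → eval (λ α → F α β) p) q
  eval-comm F []            q = sym (eval-0 q)
  eval-comm F ((r , α) ∷ p) q =
    trans (+-cong (sym (eval-scale r (F α) q)) (eval-comm F p q)) (sym (eval-+ _ _ q))

  private
    eval-term : ∀ f r α q →
                eval f (List.map (λ (s , β) → r * s , α +ᵉ β) q) ≈ r * eval (λ β → f (α +ᵉ β)) q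
    eval-term f r α []            = sym (zeroʳ r)
    eval-term f r α ((s , β) ∷ q) =
      trans (+-cong (*-assoc r s _) (eval-term f r α q)) (sym (distribˡ r _ _))

  eval-* : ∀ f p q → eval f (p *ᴾ q) ≈ eval (λ α → eval (λ β → f (α +ᵉ β)) q) p
  eval-* f []            q = refl
  eval-* f ((r , α) ∷ p) q =
    trans (eval-++ f (List.map (λ (s , β) → r * s , α +ᵉ β) q) (p *ᴾ q))
          (+-cong (eval-term f r α q) (eval-* f p q))

  private
    delete : Exponent → Poly → Poly
    delete α = filter (λ (_ , β) → ¬? (β ≟ α))

    eval-delete : ∀ f α p → eval f p ≈ coeff p α * f α + eval f (delete α p)
    eval-delete f α []            = sym (trans (+-congʳ (zeroˡ _)) (+-identityˡ 0#))
    eval-delete f α ((r , β) ∷ p) with β ≟ α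
    ... | yes ≡.refl = begin
      r * f α + eval f p                                 ≈⟨ +-congˡ (eval-delete f α p) ⟩
      r * f α + (coeff p α * f α + eval f (delete α p))  ≈⟨ +-assoc _ _ _ ⟨
      r * f α + coeff p α * f α + eval f (delete α p)    ≈⟨ +-congʳ (distribʳ (f α) r _) ⟨
      (r + coeff p α) * f α + eval f (delete α p)        ∎
    ... | no _ = begin
      r * f β + eval f p                                 ≈⟨ +-congˡ (eval-delete f α p) ⟩
      r * f β + (coeff p α * f α + eval f (delete α p))  ≈⟨ +-assoc _ _ _ ⟨
      r * f β + coeff p α * f α + eval f (delete α p)    ≈⟨ +-congʳ (+-comm _ _) ⟩
      coeff p α * f α + r * f β + eval f (delete α p)    ≈⟨ +-assoc _ _ _ ⟩
      coeff p α * f α + (r * f β + eval f (delete α p))  ∎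

    coeff-delete : ∀ α p → coeff (delete α p) α ≈ 0#
    coeff-delete α []            = refl
    coeff-delete α ((r , β) ∷ p) with β ≟ α
    ... | yes _ = coeff-delete α p
    ... | no β≢α with β ≟ α
    ...   | yes β≡α = contradiction β≡α β≢α
    ...   | no _    = coeff-delete α p

    coeff-delete-≢ : ∀ α {γ} → α ≢ γ → ∀ p → coeff (delete α p) γ ≈ coeff p γ
    coeff-delete-≢ α α≢γ []            = refl
    coeff-delete-≢ α {γ} α≢γ ((r , β) ∷ p) with β ≟ α
    coeff-delete-≢ α {γ} α≢γ ((r , β) ∷ p) | yes ≡.refl with β ≟ γ
    ... | yes β≡γ = contradiction β≡γ α≢γ
    ... | no _    = coeff-delete-≢ α α≢γ p
    coeff-delete-≢ α {γ} α≢γ ((r , β) ∷ p) | no _ with β ≟ γ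
    ... | yes _ = +-congˡ (coeff-delete-≢ α α≢γ p)
    ... | no _  = coeff-delete-≢ α α≢γ p

    delete-zero : ∀ α p → (∀ γ → coeff p γ ≈ 0#) → ∀ γ → coeff (delete α p) γ ≈ 0#
    delete-zero α p p≈0 γ with α ≟ γ
    ... | yes ≡.refl = coeff-delete α p
    ... | no α≢γ     = trans (coeff-delete-≢ α α≢γ p) (p≈0 γ)

    delete-head : ∀ r α p → length (delete α ((r , α) ∷ p)) ℕ.≤ length p
    delete-head r α p with α ≟ α
    ... | yes _  = length-filter (λ (_ , β) → ¬? (β ≟ α)) p
    ... | no α≢α = contradiction ≡.refl α≢α

    eval-zero : ∀ f s p → length p ℕ.≤ s → (∀ γ → coeff p γ ≈ 0#) → eval f p ≈ 0#
    eval-zero f s       []                _         p≈0 = refl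
    eval-zero f (suc s) p@((r , α) ∷ p′) (s≤s p≤s) p≈0 = begin
      eval f p                              ≈⟨ eval-delete f α p ⟩
      coeff p α * f α + eval f (delete α p) ≈⟨ +-congʳ (*-congʳ (p≈0 α)) ⟩
      0# * f α + eval f (delete α p)        ≈⟨ +-congʳ (zeroˡ (f α)) ⟩
      0# + eval f (delete α p)              ≈⟨ +-identityˡ _ ⟩
      eval f (delete α p)                   ≈⟨ eval-zero f s (delete α p)
                                                 (ℕ.≤-trans (delete-head r α p′) p≤s)
                                                 (delete-zero α p p≈0) ⟩
      0#                                    ∎

    eval-difference : ∀ f p q → eval f (p +ᴾ -ᴾ q) ≈ eval f p - eval f q
    eval-difference f p q = trans (eval-++ f p (-ᴾ q)) (+-congˡ (eval-neg f q))

  eval-≈ : ∀ f {p q} → p ≈ᴾ q → eval f p ≈ eval f q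
  eval-≈ f {p} {q} p≈q = x∙y⁻¹≈ε⇒x≈y _ _
    (trans (sym (eval-difference f p q)) (eval-zero f _ (p +ᴾ -ᴾ q) ℕ.≤-refl zero-coeff))
    where
    zero-coeff : ∀ γ → coeff (p +ᴾ -ᴾ q) γ ≈ 0#
    zero-coeff γ = begin
      coeff (p +ᴾ -ᴾ q) γ             ≈⟨ coeff-eval (p +ᴾ -ᴾ q) γ ⟩
      eval (δ γ) (p +ᴾ -ᴾ q)          ≈⟨ eval-difference (δ γ) p q ⟩
      eval (δ γ) p - eval (δ γ) q     ≈⟨ +-cong (coeff-eval p γ) (-‿cong (coeff-eval q γ)) ⟨
      coeff p γ - coeff q γ           ≈⟨ +-congʳ (coeff-≈ p≈q γ) ⟩
      coeff q γ - coeff q γ           ≈⟨ -‿inverseʳ _ ⟩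
      0#                              ∎

  ≈-eval : ∀ {p q} → (∀ f → eval f p ≈ eval f q) → p ≈ᴾ q
  ≈-eval {p} {q} e = coefficientwise λ α →
    trans (coeff-eval p α) (trans (e (δ α)) (sym (coeff-eval q α)))

  private
    +ᵉ-identityˡ : ∀ α → 0ᵉ +ᵉ α ≡ α
    +ᵉ-identityˡ = Vec.zipWith-identityˡ ℕ.+-identityˡ

    +ᵉ-comm : ∀ α β → α +ᵉ β ≡ β +ᵉ α
    +ᵉ-comm = Vec.zipWith-comm ℕ.+-comm

    +ᵉ-assoc : ∀ α β γ → (α +ᵉ β) +ᵉ γ ≡ α +ᵉ (β +ᵉ γ)
    +ᵉ-assoc = Vec.zipWith-assoc ℕ.+-assoc

    +ᴾ-cong : ∀ {p q u v} → p ≈ᴾ q → u ≈ᴾ v → p +ᴾ u ≈ᴾ q +ᴾ v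
    +ᴾ-cong {p} {q} {u} {v} p≈q u≈v = ≈-eval λ f →
      trans (eval-++ f p u) (trans (+-cong (eval-≈ f p≈q) (eval-≈ f u≈v)) (sym (eval-++ f q v)))

    +ᴾ-comm : ∀ p q → p +ᴾ q ≈ᴾ q +ᴾ p
    +ᴾ-comm p q = ≈-eval λ f →
      trans (eval-++ f p q) (trans (+-comm _ _) (sym (eval-++ f q p)))

    +ᴾ-assoc : ∀ p q u → (p +ᴾ q) +ᴾ u ≈ᴾ p +ᴾ (q +ᴾ u)
    +ᴾ-assoc p q u = ≈-eval λ f → begin
      eval f ((p +ᴾ q) +ᴾ u)              ≈⟨ eval-++ f (p +ᴾ q) u ⟩
      eval f (p +ᴾ q) + eval f u          ≈⟨ +-congʳ (eval-++ f p q) ⟩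
      eval f p + eval f q + eval f u      ≈⟨ +-assoc _ _ _ ⟩
      eval f p + (eval f q + eval f u)    ≈⟨ +-congˡ (eval-++ f q u) ⟨
      eval f p + eval f (q +ᴾ u)          ≈⟨ eval-++ f p (q +ᴾ u) ⟨
      eval f (p +ᴾ (q +ᴾ u))              ∎

    -ᴾ-cong : ∀ {p q} → p ≈ᴾ q → -ᴾ p ≈ᴾ -ᴾ q
    -ᴾ-cong {p} {q} p≈q = ≈-eval λ f →
      trans (eval-neg f p) (trans (-‿cong (eval-≈ f p≈q)) (sym (eval-neg f q)))

    -ᴾ-inverseʳ : ∀ p → p +ᴾ -ᴾ p ≈ᴾ 0ᴾ
    -ᴾ-inverseʳ p = ≈-eval λ f → trans (eval-difference f p p) (-‿inverseʳ _)

    *ᴾ-cong : ∀ {p q u v} → p ≈ᴾ q → u ≈ᴾ v → p *ᴾ u ≈ᴾ q *ᴾ v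
    *ᴾ-cong {p} {q} {u} {v} p≈q u≈v = ≈-eval λ f → begin
      eval f (p *ᴾ u)                                ≈⟨ eval-* f p u ⟩
      eval (λ α → eval (λ β → f (α +ᵉ β)) u) p       ≈⟨ eval-cong p (λ α → eval-≈ _ u≈v) ⟩
      eval (λ α → eval (λ β → f (α +ᵉ β)) v) p       ≈⟨ eval-≈ _ p≈q ⟩
      eval (λ α → eval (λ β → f (α +ᵉ β)) v) q       ≈⟨ eval-* f q v ⟨
      eval f (q *ᴾ v)                                ∎

    *ᴾ-comm : ∀ p q → p *ᴾ q ≈ᴾ q *ᴾ p
    *ᴾ-comm p q = ≈-eval λ f → begin
      eval f (p *ᴾ q)                            ≈⟨ eval-* f p q ⟩
      eval (λ α → eval (λ β → f (α +ᵉ β)) q) p   ≈⟨ eval-comm (λ α β → f (α +ᵉ β)) p q ⟩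
      eval (λ β → eval (λ α → f (α +ᵉ β)) p) q   ≈⟨ eval-cong q (λ β → eval-cong p λ α →
                                                     reflexive (≡.cong f (+ᵉ-comm α β))) ⟩
      eval (λ β → eval (λ α → f (β +ᵉ α)) p) q   ≈⟨ eval-* f q p ⟨
      eval f (q *ᴾ p)                            ∎

    *ᴾ-assoc : ∀ p q u → (p *ᴾ q) *ᴾ u ≈ᴾ p *ᴾ (q *ᴾ u)
    *ᴾ-assoc p q u = ≈-eval λ f → begin
      eval f ((p *ᴾ q) *ᴾ u)
        ≈⟨ eval-* f (p *ᴾ q) u ⟩
      eval (λ α → eval (λ γ → f (α +ᵉ γ)) u) (p *ᴾ q)
        ≈⟨ eval-* _ p q ⟩
      eval (λ α → eval (λ β → eval (λ γ → f ((α +ᵉ β) +ᵉ γ)) u) q) p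
        ≈⟨ eval-cong p (λ α → eval-cong q λ β → eval-cong u λ γ →
             reflexive (≡.cong f (+ᵉ-assoc α β γ))) ⟩
      eval (λ α → eval (λ β → eval (λ γ → f (α +ᵉ (β +ᵉ γ))) u) q) p
        ≈⟨ eval-cong p (λ α → eval-* (λ β → f (α +ᵉ β)) q u) ⟨
      eval (λ α → eval (λ β → f (α +ᵉ β)) (q *ᴾ u)) p
        ≈⟨ eval-* f p (q *ᴾ u) ⟨
      eval f (p *ᴾ (q *ᴾ u)) ∎

    eval-constant : ∀ f r p → eval f (constant r *ᴾ p) ≈ r * eval f p
    eval-constant f r p = begin
      eval f (constant r *ᴾ p)                 ≈⟨ eval-* f (constant r) p ⟩
      r * eval (λ β → f (0ᵉ +ᵉ β)) p + 0#      ≈⟨ +-identityʳ _ ⟩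
      r * eval (λ β → f (0ᵉ +ᵉ β)) p           ≈⟨ *-congˡ (eval-cong p λ β →
                                                   reflexive (≡.cong f (+ᵉ-identityˡ β))) ⟩
      r * eval f p                             ∎

    *ᴾ-identityˡ : ∀ p → 1ᴾ *ᴾ p ≈ᴾ p
    *ᴾ-identityˡ p = ≈-eval λ f → trans (eval-constant f 1# p) (*-identityˡ _)

    *ᴾ-distribʳ : ∀ u p q → (p +ᴾ q) *ᴾ u ≈ᴾ p *ᴾ u +ᴾ q *ᴾ u
    *ᴾ-distribʳ u p q = ≈-eval λ f → begin
      eval f ((p +ᴾ q) *ᴾ u)                ≈⟨ eval-* f (p +ᴾ q) u ⟩
      eval (F f) (p +ᴾ q)                   ≈⟨ eval-++ (F f) p q ⟩
      eval (F f) p + eval (F f) q           ≈⟨ +-cong (eval-* f p u) (eval-* f q u) ⟨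
      eval f (p *ᴾ u) + eval f (q *ᴾ u)     ≈⟨ eval-++ f (p *ᴾ u) (q *ᴾ u) ⟨
      eval f (p *ᴾ u +ᴾ q *ᴾ u)             ∎
      where
      F : (Exponent → K) → Exponent → K
      F f α = eval (λ β → f (α +ᵉ β)) u

    transᴾ : ∀ {p q u} → p ≈ᴾ q → q ≈ᴾ u → p ≈ᴾ u
    transᴾ p≈q q≈u = coefficientwise λ α → trans (coeff-≈ p≈q α) (coeff-≈ q≈u α)

  polynomialRing : CommutativeRing c ℓ
  polynomialRing = record
    { Carrier           = Poly
    ; _≈_               = _≈ᴾ_
    ; _+_               = _+ᴾ_
    ; _*_               = _*ᴾ_
    ; -_                = -ᴾ_
    ; 0#                = 0ᴾ
    ; 1#                = 1ᴾ
    ; isCommutativeRing = record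
      { isRing = record
        { +-isAbelianGroup = record
          { isGroup = record
            { isMonoid = record
              { isSemigroup = record
                { isMagma = record
                  { isEquivalence = record
                    { refl  = coefficientwise λ _ → refl
                    ; sym   = λ p≈q → coefficientwise λ α → sym (coeff-≈ p≈q α)
                    ; trans = transᴾ
                    }
                  ; ∙-cong = +ᴾ-cong
                  }
                ; assoc = +ᴾ-assoc
                }
              ; identity = (λ _ → coefficientwise λ _ → refl) , (λ p → +ᴾ-comm p 0ᴾ)
              }
            ; inverse = (λ p → transᴾ (+ᴾ-comm (-ᴾ p) p) (-ᴾ-inverseʳ p)) , -ᴾ-inverseʳ
            ; ⁻¹-cong = -ᴾ-cong
            }
          ; comm = +ᴾ-comm
          }
        ; *-cong     = *ᴾ-cong
        ; *-assoc    = *ᴾ-assoc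
        ; *-identity = *ᴾ-identityˡ , (λ p → transᴾ (*ᴾ-comm p 1ᴾ) (*ᴾ-identityˡ p))
        ; distrib    = (λ u p q → transᴾ (*ᴾ-comm u (p +ᴾ q))
                                  (transᴾ (*ᴾ-distribʳ u p q)
                                          (+ᴾ-cong (*ᴾ-comm p u) (*ᴾ-comm q u))))
                     , *ᴾ-distribʳ
        }
      ; *-comm = *ᴾ-comm
      }
    }

  open RingMorphisms rawRing (CommutativeRing.rawRing polynomialRing) using (IsRingHomomorphism)

  constant-isRingHomomorphism : IsRingHomomorphism constant
  constant-isRingHomomorphism = record
    { isSemiringHomomorphism = record
      { isNearSemiringHomomorphism = record
        { +-isMonoidHomomorphism = record
          { isMagmaHomomorphism = record
            { isRelHomomorphism = record
              { cong = λ r≈s → ≈-eval λ f → +-congʳ (*-congʳ r≈s) }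
            ; homo = λ r s → ≈-eval λ f →
                trans (+-congʳ (distribʳ (f 0ᵉ) r s)) (+-assoc _ _ _)
            }
          ; ε-homo = ≈-eval λ f → trans (+-congʳ (zeroˡ (f 0ᵉ))) (+-identityˡ 0#)
          }
        ; *-homo = λ r s → ≈-eval λ f → begin
            r * s * f 0ᵉ + 0#                     ≈⟨ +-identityʳ _ ⟩
            r * s * f 0ᵉ                          ≈⟨ *-assoc r s (f 0ᵉ) ⟩
            r * (s * f 0ᵉ)                        ≈⟨ *-congˡ (+-identityʳ _) ⟨
            r * eval f (constant s)               ≈⟨ eval-constant f r (constant s) ⟨
            eval f (constant r *ᴾ constant s)     ∎
        }
      ; 1#-homo = coefficientwise λ _ → refl
      }
    ; -‿homo = λ r → coefficientwise λ _ → refl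
    }

  -- The zero polynomial satisfies deg 0 < d for every d.
  infix 4 deg_<_
  deg_<_ : Poly → ℕ → Set ℓ
  deg p < d = ∀ α → d ℕ.≤ ∣ α ∣ → coeff p α ≈ 0#

  -- The sum of all monomials x^α with |α| = m, over α ∈ ℕᵏ.
  h : ℕ → Poly
  h m = List.map (λ α → 1# , α) (multiIndices k m)

  quotient : Ideal polynomialRing (c ⊔ ℓ) → Module R c (c ⊔ ℓ)
  quotient J = Quotient.quotientModule polynomialRing J R constant-isRingHomomorphism

  residueClass : (J : Ideal polynomialRing (c ⊔ ℓ)) → Poly → Module.Carrierᴹ (quotient J)
  residueClass J = Quotient.residue polynomialRing J

{-# OPTIONS --safe #-}
module Submission where

-- Write N = n − k.  Applying h_m(x_{i+1}, …, x_k) = h_m(x_i, …, x_k) − x_i h_{m−1}(x_i, …, x_k)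
-- repeatedly to the given generators produces another generating set f_1, …, f_k of J, where
-- f_i equals h_{N+i}(x_i, …, x_k) up to terms of degree < N + i.  If x_i has weight C + k − i + 1
-- with C large, then x_i^{N+i} is heavier than every other monomial of f_i.  Reducing by the f_i
-- lowers the weight, so the standard monomials span.  For their independence, any function on
-- the standard monomials extends, by recursion on the weight, to a linear functional on 𝒫; it
-- kills J because the leading monomials x_i^{N+i} are pairwise coprime, so that the result of
-- a reduction does not depend on the choices made (Buchberger's criterion).

open import Defs
open import Algebra.Bundles using (CommutativeRing)
import Algebra.Properties.Group as GroupProperties
import Algebra.Properties.Ring as RingProperties
import Algebra.Properties.Semiring.Sum as SemiringSum
open import Data.Bool.Base using (Bool; true; false; T; if_then_else_)
open import Data.Fin.Base as Fin using (Fin; toℕ)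
import Data.Fin.Properties as Fin
open import Data.Irrelevant using ([_])
open import Data.List.Base as List using (List; []; _∷_; _++_; length; map; filter)
open import Data.List.Membership.Propositional using (_∈_)
import Data.List.Properties as List
open import Data.List.Relation.Unary.All as All using (All; []; _∷_)
import Data.List.Relation.Unary.All.Properties as All
open import Data.List.Relation.Unary.AllPairs using (_∷_)
open import Data.List.Relation.Unary.Any using (here; there)
open import Data.List.Relation.Unary.Unique.Propositional using (Unique)
open import Data.Nat.Base as ℕ using (ℕ; zero; suc; _∸_; _≤_; _<_; _≡ᵇ_; z≤n; s≤s; z<s)
import Data.Nat.Properties as ℕ
open import Data.Product.Base using (Σ; ∃-syntax; _×_; _,_; proj₁; proj₂; map₂)
open import Data.Refinement using (Refinement-syntax; value)
open import Data.Sum.Base using (_⊎_; inj₁; inj₂)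
open import Data.Vec.Base using (Vec; []; _∷_; lookup; replicate; zipWith)
import Data.Vec.Properties as Vec
open import Data.Vec.Functional using (Vector)
open import Function.Base using (_∘_)
open import Function.Definitions using (Injective)
open import Level using (_⊔_)
open import Relation.Binary.PropositionalEquality as ≡ using (_≡_; _≢_)
open import Relation.Nullary using (¬_; yes; no; does; contradiction; recompute)
open import Relation.Nullary.Decidable using (dec-true; dec-false)
open import Relation.Unary using (Pred; Decidable)

-- Exponent vectors and the monomials of complete homogeneous polynomials.

module _ where
  open ≡ using (refl; sym; trans; cong; cong₂; subst)
  open import Data.Nat.Base using (_+_; _*_)
  open import Data.Nat.Properties
  open import Algebra.Properties.CommutativeSemigroup ℕ.+-commutativeSemigroup using (interchange)

  -- The exponent of the pure power x_{i+1}^d. The index is a natural number rather than an element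
  -- of `Fin k`, so that `descent` can recurse on it; for i ≥ k the vector is zero.
  single : ∀ {k} → ℕ → ℕ → Vec ℕ k
  single {zero}  _       _ = []
  single {suc k} zero    d = d ∷ replicate k 0
  single {suc k} (suc i) d = 0 ∷ single i d

  lookup-+-single-≢ : ∀ {k} (α : Vec ℕ k) i d (j : Fin k) → i ≢ toℕ j →
                      lookup (zipWith _+_ α (single i d)) j ≡ lookup α j
  lookup-+-single-≢ (x ∷ α) zero    d Fin.zero    i≢j = contradiction refl i≢j
  lookup-+-single-≢ (x ∷ α) zero    d (Fin.suc j) i≢j =
    cong (λ β → lookup β j) (Vec.zipWith-identityʳ +-identityʳ α)
  lookup-+-single-≢ (x ∷ α) (suc i) d Fin.zero    i≢j = +-identityʳ x
  lookup-+-single-≢ (x ∷ α) (suc i) d (Fin.suc j) i≢j = lookup-+-single-≢ α i d j (λ e → i≢j (cong suc e))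

  lookup-+-single-≥ : ∀ {k} (α : Vec ℕ k) (i : Fin k) d → d ≤ lookup (zipWith _+_ α (single (toℕ i) d)) i
  lookup-+-single-≥ (x ∷ α) Fin.zero    d = m≤n+m d x
  lookup-+-single-≥ (x ∷ α) (Fin.suc i) d = lookup-+-single-≥ α i d

  subtract-single : ∀ {k} (α : Vec ℕ k) (i : Fin k) {d} → d ≤ lookup α i →
                    ∃[ γ ] zipWith _+_ γ (single (toℕ i) d) ≡ α
  subtract-single (x ∷ α) Fin.zero {d} d≤x =
    (x ∸ d) ∷ α , cong₂ _∷_ (m∸n+n≡m d≤x) (Vec.zipWith-identityʳ +-identityʳ α)
  subtract-single (x ∷ α) (Fin.suc i) d≤αᵢ with subtract-single α i d≤αᵢ
  ... | γ , e = x ∷ γ , cong₂ _∷_ (+-identityʳ x) e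

  ∣replicate-0∣ : ∀ k → ∣ replicate k 0 ∣ ≡ 0
  ∣replicate-0∣ zero    = refl
  ∣replicate-0∣ (suc k) = ∣replicate-0∣ k

  ∣single∣ : ∀ {k i} → i < k → ∀ d → ∣ single {k} i d ∣ ≡ d
  ∣single∣ {suc k} {zero}  _         d = trans (cong (d +_) (∣replicate-0∣ k)) (+-identityʳ d)
  ∣single∣ {suc k} {suc i} (s≤s i<k) d = ∣single∣ i<k d

  ∣∣≡0⇒≡replicate-0 : ∀ {k} (α : Vec ℕ k) → ∣ α ∣ ≡ 0 → α ≡ replicate k 0
  ∣∣≡0⇒≡replicate-0 []      _ = refl
  ∣∣≡0⇒≡replicate-0 (x ∷ α) e =
    cong₂ _∷_ (m+n≡0⇒m≡0 x e) (∣∣≡0⇒≡replicate-0 α (m+n≡0⇒n≡0 x e))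

  ∣+∣ : ∀ {k} (α β : Vec ℕ k) → ∣ zipWith _+_ α β ∣ ≡ ∣ α ∣ + ∣ β ∣
  ∣+∣ []      []      = refl
  ∣+∣ (x ∷ α) (y ∷ β) = trans (cong (x + y +_) (∣+∣ α β)) (interchange x y ∣ α ∣ ∣ β ∣)

  -- Whether x^α occurs in h_m(x_{i+1}, …, x_k); here and below, i counts from 0.
  occurs : ∀ {k} → ℕ → ℕ → Vec ℕ k → Bool
  occurs zero    m α           = ∣ α ∣ ≡ᵇ m
  occurs (suc i) m []          = false
  occurs (suc i) m (zero  ∷ α) = occurs i m α
  occurs (suc i) m (suc _ ∷ α) = false

  occurs-single : ∀ {k i} → i < k → ∀ m → occurs i m (single {k} i m) ≡ true
  occurs-single {suc k} {zero}  _         m = trans (cong (_≡ᵇ m) (∣single∣ {suc k} z<s m)) (≡ᵇ-refl m)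
    where
    ≡ᵇ-refl : ∀ m → (m ≡ᵇ m) ≡ true
    ≡ᵇ-refl zero    = refl
    ≡ᵇ-refl (suc m) = ≡ᵇ-refl m
  occurs-single {suc k} {suc i} (s≤s i<k) m = occurs-single i<k m

  -- A weight that makes pure powers leading monomials.

  module Weight (C : ℕ) where

    -- Earlier variables are slightly heavier, which singles out one monomial within a given degree;
    -- a large common summand C keeps monomials of smaller degree below it.
    weight : ∀ {k} → Vec ℕ k → ℕ
    weight []              = 0
    weight {suc k} (x ∷ α) = x * (C + suc k) + weight α

    weight-+ : ∀ {k} (α β : Vec ℕ k) → weight (zipWith _+_ α β) ≡ weight α + weight β
    weight-+ []              []      = refl
    weight-+ {suc k} (x ∷ α) (y ∷ β) =
      trans (cong₂ _+_ (*-distribʳ-+ (C + suc k) x y) (weight-+ α β))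
            (interchange (x * (C + suc k)) (y * (C + suc k)) (weight α) (weight β))

    weight-≤ : ∀ {k} (α : Vec ℕ k) → weight α ≤ ∣ α ∣ * (C + k)
    weight-≤ []              = z≤n
    weight-≤ {suc k} (x ∷ α) = begin
      x * (C + suc k) + weight α             ≤⟨ +-monoʳ-≤ (x * (C + suc k)) (weight-≤ α) ⟩
      x * (C + suc k) + ∣ α ∣ * (C + k)      ≤⟨ +-monoʳ-≤ (x * (C + suc k))
                                                  (*-monoʳ-≤ ∣ α ∣ (+-monoʳ-≤ C (n≤1+n k))) ⟩
      x * (C + suc k) + ∣ α ∣ * (C + suc k)  ≡⟨ *-distribʳ-+ (C + suc k) x ∣ α ∣ ⟨
      (x + ∣ α ∣) * (C + suc k)              ∎
      where open ≤-Reasoning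

    weight-single-≥ : ∀ {k i} → i < k → ∀ d → d * suc C ≤ weight (single {k} i d)
    weight-single-≥ {suc k} {zero}  _         d =
      ≤-trans (*-monoʳ-≤ d (≤-trans (≤-reflexive (+-comm 1 C)) (+-monoʳ-≤ C (s≤s z≤n)))) (m≤m+n _ _)
    weight-single-≥ {suc k} {suc i} (s≤s i<k) d = weight-single-≥ i<k d

    -- Every variable weighs between C + 1 and C + k. So a degree of at most d - 1 gives a weight of
    -- at most (d - 1)(C + k) ≤ (d - 1)C + kd ≤ dC, which is less than d(C + 1).
    ∣∣<⇒weight<single : ∀ {k i} → i < k → ∀ {d} → k * d ≤ C → (α : Vec ℕ k) → ∣ α ∣ < d →
                        weight α < weight (single {k} i d)
    ∣∣<⇒weight<single {k} {i} i<k {suc d} kd≤C α (s≤s ∣α∣≤d) = begin-strict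
      weight α                ≤⟨ weight-≤ α ⟩
      ∣ α ∣ * (C + k)         ≡⟨ *-distribˡ-+ ∣ α ∣ C k ⟩
      ∣ α ∣ * C + ∣ α ∣ * k   ≤⟨ +-mono-≤ (*-monoˡ-≤ C ∣α∣≤d) (begin
                                   ∣ α ∣ * k   ≡⟨ *-comm ∣ α ∣ k ⟩
                                   k * ∣ α ∣   ≤⟨ *-monoʳ-≤ k (m≤n⇒m≤1+n ∣α∣≤d) ⟩
                                   k * suc d   ≤⟨ kd≤C ⟩
                                   C           ∎) ⟩
      d * C + C               ≡⟨ +-comm (d * C) C ⟩
      suc d * C               <⟨ *-monoʳ-< (suc d) (n<1+n C) ⟩
      suc d * suc C           ≤⟨ weight-single-≥ i<k (suc d) ⟩
      weight (single {k} i (suc d)) ∎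
      where open ≤-Reasoning

    -- Among the monomials of degree m in x_{i+1}, ..., x_k, trading a factor x_{i+1} for a later
    -- variable loses weight, so x_{i+1}^m alone is heaviest.
    occurs-heavy⇒single : ∀ {k i} → i < k → ∀ m (α : Vec ℕ k) → occurs i m α ≡ true →
                          weight (single {k} i m) ≤ weight α → α ≡ single i m
    occurs-heavy⇒single {suc k} {zero} _ m (x ∷ α) occ w≤ = cong₂ _∷_ x≡m α≡0
      where
      open ≤-Reasoning
      m≡ : x + ∣ α ∣ ≡ m
      m≡ = ≡ᵇ⇒≡ (x + ∣ α ∣) m (subst T (sym occ) _)
      -- Each unit of degree in the tail of the exponent would have to contribute C + k + 1, but
      -- contributes at most C + k; hence the tail is zero.
      bound : x * (C + suc k) + ∣ α ∣ * (C + suc k) ≤ x * (C + suc k) + ∣ α ∣ * (C + k)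
      bound = begin
        x * (C + suc k) + ∣ α ∣ * (C + suc k)  ≡⟨ *-distribʳ-+ (C + suc k) x ∣ α ∣ ⟨
        (x + ∣ α ∣) * (C + suc k)              ≡⟨ cong (_* (C + suc k)) m≡ ⟩
        m * (C + suc k)                        ≤⟨ m≤m+n _ _ ⟩
        weight (single {suc k} zero m)         ≤⟨ w≤ ⟩
        x * (C + suc k) + weight α             ≤⟨ +-monoʳ-≤ (x * (C + suc k)) (weight-≤ α) ⟩
        x * (C + suc k) + ∣ α ∣ * (C + k)      ∎
      vanish : ∀ s → s * (C + suc k) ≤ s * (C + k) → s ≡ 0
      vanish zero    _  = refl
      vanish (suc s) le = contradiction (*-cancelˡ-≤ (suc s) le) (<⇒≱ (+-monoʳ-< C (n<1+n k)))
      ∣α∣≡0 : ∣ α ∣ ≡ 0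
      ∣α∣≡0 = vanish ∣ α ∣ (+-cancelˡ-≤ (x * (C + suc k)) _ _ bound)
      x≡m : x ≡ m
      x≡m = trans (sym (trans (cong (x +_) ∣α∣≡0) (+-identityʳ x))) m≡
      α≡0 = ∣∣≡0⇒≡replicate-0 α ∣α∣≡0
    occurs-heavy⇒single {suc k} {suc i} (s≤s i<k) m (zero ∷ α) occ w≤ =
      cong (0 ∷_) (occurs-heavy⇒single i<k m α occ w≤)

  -- The recursion for h, one monomial at a time. Either x_{i+1} does not divide x^α, and dropping
  -- this variable changes nothing; or x^α = x_{i+1} x^β, and x^α occurs in h_{m+1} exactly when x^β
  -- occurs in h_m.
  occurs-suc : ∀ {k i} → i < k → (α : Vec ℕ k) →
    ((∀ β → zipWith _+_ (single i 1) β ≢ α) × (∀ m → occurs (suc i) m α ≡ occurs i m α)) ⊎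
    (∃[ β ] zipWith _+_ (single i 1) β ≡ α ×
      (∀ m → occurs i (suc m) α ≡ occurs i m β) × (∀ m → occurs (suc i) m α ≡ false))
  occurs-suc {suc k} {zero} _ (zero  ∷ α) = inj₁ ((λ { (_ ∷ _) () }) , λ _ → refl)
  occurs-suc {suc k} {zero} _ (suc x ∷ α) =
    inj₂ (x ∷ α , cong (suc x ∷_) (Vec.zipWith-identityˡ +-identityˡ α) , (λ _ → refl) , λ _ → refl)
  occurs-suc {suc k} {suc i} (s≤s i<k) (suc x ∷ α) with occurs-suc i<k α
  ... | inj₁ (none , _) = inj₁ ((λ { (_ ∷ β) refl → none β refl }) , λ _ → refl)
  ... | inj₂ (β , e , _) = inj₂ (suc x ∷ β , cong (suc x ∷_) e , (λ _ → refl) , λ _ → refl)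
  occurs-suc {suc k} {suc i} (s≤s i<k) (zero ∷ α) with occurs-suc i<k α
  ... | inj₁ (none , same)        = inj₁ ((λ { (_ ∷ β) refl → none β refl }) , same)
  ... | inj₂ (β , e , down , off) = inj₂ (0 ∷ β , cong (0 ∷_) e , down , off)

-- Generated ideals and finite sums.

module _ {c ℓ p} {A : CommutativeRing c ℓ} (I : Ideal A p) where
  open CommutativeRing A
  open Ideal I
  open SemiringSum semiring using (sum)

  sum-closed : ∀ {s} (v : Vector Carrier s) → (∀ i → Member (v i)) → Member (sum v)
  sum-closed {zero}  v v∈I = 0-closed
  sum-closed {suc s} v v∈I = +-closed (v∈I Fin.zero) (sum-closed (v ∘ Fin.suc) (v∈I ∘ Fin.suc))

  generatedIdeal⊆ : ∀ {s} (g : Vector Carrier s) → (∀ i → Member (g i)) →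
                    ∀ {x} → Ideal.Member (generatedIdeal A g) x → Member x
  generatedIdeal⊆ g g∈I (q , e) =
    resp (sym e) (sum-closed (λ i → q i * g i) (λ i → *-closed (q i) (g∈I i)))

module _ {c ℓ} (A : CommutativeRing c ℓ) where
  open CommutativeRing A
  open SemiringSum semiring using (sum; sum-cong-≋; sum-replicate-zero; sum-remove)
  open import Relation.Binary.Reasoning.Setoid setoid

  sum-zero : ∀ {s} (v : Vector Carrier s) → (∀ i → v i ≈ 0#) → sum v ≈ 0#
  sum-zero {s} v v≈0 = trans (sum-cong-≋ v≈0) (sum-replicate-zero s)

  sum-unique : ∀ {s} (v : Vector Carrier s) j → (∀ i → i ≢ j → v i ≈ 0#) → sum v ≈ v j
  sum-unique {suc s} v j v≈0 = begin
    sum v                           ≈⟨ sum-remove {i = j} v ⟩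
    v j + sum (v ∘ Fin.punchIn j)   ≈⟨ +-congˡ (sum-zero _ (λ i → v≈0 _ (Fin.punchInᵢ≢i j i))) ⟩
    v j + 0#                        ≈⟨ +-identityʳ (v j) ⟩
    v j                             ∎

  generator∈ : ∀ {s} (g : Vector Carrier s) j → Ideal.Member (generatedIdeal A g) (g j)
  generator∈ g j = (λ i → if does (i Fin.≟ j) then 1# else 0#) , sym (begin
    sum (λ i → (if does (i Fin.≟ j) then 1# else 0#) * g i)
      ≈⟨ sum-unique _ j (λ i i≢j → trans (*-congʳ (reflexive (≡.cong (if_then 1# else 0#)
           (dec-false (i Fin.≟ j) i≢j)))) (zeroˡ (g i))) ⟩
    (if does (j Fin.≟ j) then 1# else 0#) * g j
      ≈⟨ *-congʳ (reflexive (≡.cong (if_then 1# else 0#) (dec-true (j Fin.≟ j) ≡.refl))) ⟩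
    1# * g j
      ≈⟨ *-identityˡ (g j) ⟩
    g j ∎)

-- Coefficients of polynomials and linear functionals on them.

module _ {c ℓ} (R : CommutativeRing c ℓ) (k : ℕ) where
  open CommutativeRing R renaming (Carrier to K)
  open Polynomial R k
  open RingProperties ring using (-‿distribʳ-*; -‿+-comm; -0#≈0#; -1*x≈-x)
  open import Relation.Binary.Reasoning.Setoid setoid
  private module 𝒫 = CommutativeRing polynomialRing

  δ-≡ : ∀ {α β} → β ≡ α → δ α β ≡ 1#
  δ-≡ {α} {β} e = ≡.cong (if_then 1# else 0#) (dec-true (β ≟ α) e)

  δ-≢ : ∀ {α β} → β ≢ α → δ α β ≡ 0#
  δ-≢ {α} {β} e = ≡.cong (if_then 1# else 0#) (dec-false (β ≟ α) e)

  +ᵉ-cancelˡ : ∀ (γ : Exponent) {α β} → γ +ᵉ α ≡ γ +ᵉ β → α ≡ β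
  +ᵉ-cancelˡ γ e = cancel γ _ _ e
    where
    cancel : ∀ {n} (γ α β : Vec ℕ n) → zipWith ℕ._+_ γ α ≡ zipWith ℕ._+_ γ β → α ≡ β
    cancel []      []      []      _ = ≡.refl
    cancel (x ∷ γ) (y ∷ α) (z ∷ β) e =
      ≡.cong₂ _∷_ (ℕ.+-cancelˡ-≡ x y z (Vec.∷-injectiveˡ e)) (cancel γ α β (Vec.∷-injectiveʳ e))

  +ᵉ-assoc : ∀ α β γ → (α +ᵉ β) +ᵉ γ ≡ α +ᵉ (β +ᵉ γ)
  +ᵉ-assoc = Vec.zipWith-assoc ℕ.+-assoc

  +ᵉ-comm : ∀ α β → α +ᵉ β ≡ β +ᵉ α
  +ᵉ-comm = Vec.zipWith-comm ℕ.+-comm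

  +ᵉ-swapʳ : ∀ α β γ → (α +ᵉ β) +ᵉ γ ≡ (α +ᵉ γ) +ᵉ β
  +ᵉ-swapʳ α β γ = ≡.trans (+ᵉ-assoc α β γ)
    (≡.trans (≡.cong (α +ᵉ_) (+ᵉ-comm β γ)) (≡.sym (+ᵉ-assoc α γ β)))

  +ᵉ-identityˡ : ∀ α → 0ᵉ +ᵉ α ≡ α
  +ᵉ-identityˡ = Vec.zipWith-identityˡ ℕ.+-identityˡ

  -- Unlike `eval-cong`, this asks for agreement only at the exponents listed in p, which is all
  -- that a recursion on the weight provides.
  eval-cong-All : ∀ {f g p} → All (λ (_ , α) → f α ≈ g α) p → eval f p ≈ eval g p
  eval-cong-All []         = refl
  eval-cong-All (fα≈gα ∷ f≈g) = +-cong (*-congˡ fα≈gα) (eval-cong-All f≈g)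

  eval-neg-functional : ∀ f p → eval (λ α → - f α) p ≈ - eval f p
  eval-neg-functional f []            = sym -0#≈0#
  eval-neg-functional f ((r , α) ∷ p) =
    trans (+-cong (sym (-‿distribʳ-* r (f α))) (eval-neg-functional f p)) (-‿+-comm _ _)

  eval-monomial : ∀ f α → eval f (monomial α) ≈ f α
  eval-monomial f α = trans (+-identityʳ _) (*-identityˡ (f α))

  eval-monomial-* : ∀ f γ p → eval f (monomial γ *ᴾ p) ≈ eval (λ β → f (γ +ᵉ β)) p
  eval-monomial-* f γ p = trans (eval-* f (monomial γ) p) (eval-monomial (λ α → eval (λ β → f (α +ᵉ β)) p) γ)

  eval-constant-* : ∀ f r p → eval f (constant r *ᴾ p) ≈ r * eval f p
  eval-constant-* f r p = trans (eval-* f (constant r) p) (trans (+-identityʳ _)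
    (*-congˡ (eval-cong p (λ β → reflexive (≡.cong f (+ᵉ-identityˡ β))))))

  coeff-+ : ∀ p q α → coeff (p +ᴾ q) α ≈ coeff p α + coeff q α
  coeff-+ p q α = trans (coeff-eval (p +ᴾ q) α) (trans (eval-++ (δ α) p q)
    (sym (+-cong (coeff-eval p α) (coeff-eval q α))))

  coeff-neg : ∀ p α → coeff (-ᴾ p) α ≈ - coeff p α
  coeff-neg p α = trans (coeff-eval (-ᴾ p) α) (trans (eval-neg (δ α) p)
    (-‿cong (sym (coeff-eval p α))))

  coeff-monomial : ∀ β α → coeff (monomial β) α ≈ δ α β
  coeff-monomial β α = trans (coeff-eval (monomial β) α) (eval-monomial (δ α) β)

  coeff-monomial-* : ∀ γ p α → coeff (monomial γ *ᴾ p) (γ +ᵉ α) ≈ coeff p α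
  coeff-monomial-* γ p α = begin
    coeff (monomial γ *ᴾ p) (γ +ᵉ α)          ≈⟨ coeff-eval (monomial γ *ᴾ p) (γ +ᵉ α) ⟩
    eval (δ (γ +ᵉ α)) (monomial γ *ᴾ p)       ≈⟨ eval-monomial-* _ γ p ⟩
    eval (λ β → δ (γ +ᵉ α) (γ +ᵉ β)) p        ≈⟨ eval-cong p (λ β → reflexive (δ-shift β)) ⟩
    eval (δ α) p                              ≈⟨ coeff-eval p α ⟨
    coeff p α                                 ∎
    where
    δ-shift : ∀ β → δ (γ +ᵉ α) (γ +ᵉ β) ≡ δ α β
    δ-shift β with β ≟ α
    ... | yes e = δ-≡ (≡.cong (γ +ᵉ_) e)
    ... | no ne = δ-≢ (λ e → ne (+ᵉ-cancelˡ γ e))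

  coeff-monomial-*-∤ : ∀ γ p α → (∀ β → γ +ᵉ β ≢ α) → coeff (monomial γ *ᴾ p) α ≈ 0#
  coeff-monomial-*-∤ γ p α γ∤α = begin
    coeff (monomial γ *ᴾ p) α          ≈⟨ coeff-eval (monomial γ *ᴾ p) α ⟩
    eval (δ α) (monomial γ *ᴾ p)       ≈⟨ eval-monomial-* _ γ p ⟩
    eval (λ β → δ α (γ +ᵉ β)) p        ≈⟨ eval-cong p (λ β → reflexive (δ-≢ (γ∤α β))) ⟩
    eval (λ _ → 0#) p                  ≈⟨ eval-0 p ⟩
    0#                                 ∎

  module _ {q} {Q : Pred Exponent q} (Q? : Decidable Q) where

    -- Terms are deleted from the list itself, so that every exponent still listed satisfies Q, even
    -- where coefficients vanish or cancel.
    restrict : Poly → Poly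
    restrict = filter (Q? ∘ proj₂)

    coeff-restrict-∈ : ∀ p {α} → Q α → coeff (restrict p) α ≈ coeff p α
    coeff-restrict-∈ []            Qα = refl
    coeff-restrict-∈ ((r , β) ∷ p) {α} Qα with Q? β
    ... | no ¬Qβ = trans (coeff-restrict-∈ p Qα)
                         (reflexive (≡.sym (≡.cong (if_then _ else _)
                           (dec-false (β ≟ α) λ { ≡.refl → ¬Qβ Qα }))))
    ... | yes _ with β ≟ α
    ...   | yes _ = +-congˡ (coeff-restrict-∈ p Qα)
    ...   | no _  = coeff-restrict-∈ p Qα

    coeff-restrict-∉ : ∀ p {α} → ¬ Q α → coeff (restrict p) α ≈ 0#
    coeff-restrict-∉ []            ¬Qα = refl
    coeff-restrict-∉ ((r , β) ∷ p) {α} ¬Qα with Q? β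
    ... | no _ = coeff-restrict-∉ p ¬Qα
    ... | yes Qβ with β ≟ α
    ...   | yes ≡.refl = contradiction Qβ ¬Qα
    ...   | no _       = coeff-restrict-∉ p ¬Qα

  -- The largest ideal on which the functional x^α ↦ φ α vanishes. Quantifying over the shifts γ
  -- makes it an ideal, so that membership need only be tested on generators.
  annihilator : (Exponent → K) → Ideal polynomialRing _
  annihilator φ = record
    { Member   = λ p → ∀ γ → eval (λ β → φ (γ +ᵉ β)) p ≈ 0#
    ; resp     = λ p≈q p∈ γ → trans (eval-≈ _ (𝒫.sym p≈q)) (p∈ γ)
    ; 0-closed = λ γ → refl
    ; +-closed = λ {p} {q} p∈ q∈ γ →
        trans (eval-++ _ p q) (trans (+-cong (p∈ γ) (q∈ γ)) (+-identityˡ 0#))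
    ; *-closed = λ p {q} q∈ γ → trans (eval-* _ p q) (trans
        (eval-cong p (λ α → trans
          (eval-cong q (λ β → reflexive (≡.cong φ (≡.sym (+ᵉ-assoc γ α β))))) (q∈ (γ +ᵉ α))))
        (eval-0 p))
    }

  -- Reduction by polynomials with coprime leading monomials.

  module Reduction
    (w : Exponent → ℕ) (w-+ : ∀ α β → w (α +ᵉ β) ≡ w α ℕ.+ w β)
    (d : Fin k → ℕ) (tail : Fin k → Poly)
    (tail-small : ∀ i → All (λ (_ , β) → w β < w (single (toℕ i) (d i))) (tail i))
    where

    lead : Fin k → Exponent
    lead i = single (toℕ i) (d i)

    Standard : Exponent → Set
    Standard α = ∀ i → lookup α i < d i

    -- Selects one applicable rule x^(lead i) → - tail i; `φ-lead` shows that the choice is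
    -- immaterial.
    split : ∀ α → Standard α ⊎ ∃[ i ] ∃[ γ ] γ +ᵉ lead i ≡ α
    split α with Fin.any? (λ i → d i ℕ.≤? lookup α i)
    ... | yes (i , dᵢ≤αᵢ) = inj₂ (i , subtract-single α i dᵢ≤αᵢ)
    ... | no none         = inj₁ (λ i → ℕ.≰⇒> (λ dᵢ≤αᵢ → none (i , dᵢ≤αᵢ)))

    lead≰standard : ∀ {γ i} → ¬ Standard (γ +ᵉ lead i)
    lead≰standard {γ} {i} std = ℕ.<⇒≱ (std i) (lookup-+-single-≥ γ i (d i))

    w-shift : ∀ γ {β β′} → w β < w β′ → w (γ +ᵉ β) < w (γ +ᵉ β′)
    w-shift γ {β} {β′} β<β′ = ≡.subst₂ _<_ (≡.sym (w-+ γ β)) (≡.sym (w-+ γ β′)) (ℕ.+-monoʳ-< (w γ) β<β′)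

    tail-shift : ∀ γ i → All (λ (_ , β) → w (γ +ᵉ β) < w (γ +ᵉ lead i)) (tail i)
    tail-shift γ i = All.map (w-shift γ) (tail-small i)

    module _ (f : Exponent → K) where
      private
        -- The first argument bounds the recursion depth; φ′ s α does not depend
        -- on s as long as s > w α.
        φ′ : ℕ → Exponent → K
        φ′ zero    α = 0#
        φ′ (suc s) α with split α
        ... | inj₁ _           = f α
        ... | inj₂ (i , γ , _) = - eval (λ β → φ′ s (γ +ᵉ β)) (tail i)

        -- Both sides follow the same `split`, and each reduction lowers the weight, so both bounds
        -- remain sufficient.
        φ′-stable : ∀ {s s′} α → w α < s → w α < s′ → φ′ s α ≈ φ′ s′ α
        φ′-stable {suc s} {suc s′} α (s≤s w≤s) (s≤s w≤s′) with split α
        ... | inj₁ _                = refl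
        ... | inj₂ (i , γ , ≡.refl) = -‿cong (eval-cong-All (All.map (λ w<w →
              φ′-stable _ (ℕ.<-≤-trans w<w w≤s) (ℕ.<-≤-trans w<w w≤s′)) (tail-shift γ i)))

      -- Extends f from the standard exponents to a functional that vanishes on all multiples of the
      -- reducers.
      φ : Exponent → K
      φ α = φ′ (suc (w α)) α

      φ-standard : ∀ {α} → Standard α → φ α ≡ f α
      φ-standard {α} std with split α
      ... | inj₁ _                = ≡.refl
      ... | inj₂ (i , γ , ≡.refl) = contradiction std (lead≰standard {γ} {i})

      private
        φ-split : ∀ α → ¬ Standard α → ∃[ j ] ∃[ γ ] γ +ᵉ lead j ≡ α ×
                  φ α ≈ - eval (λ β → φ (γ +ᵉ β)) (tail j)
        φ-split α ¬std with split α
        ... | inj₁ std              = contradiction std ¬std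
        ... | inj₂ (j , γ , ≡.refl) = j , γ , ≡.refl , -‿cong (eval-cong-All (All.map (λ w<w →
              φ′-stable _ w<w (ℕ.n<1+n _)) (tail-shift γ j)))

        -- The leading monomials of f_i and f_j being coprime, a monomial divisible
        -- by both can be reduced with either of them, with the same outcome.
        φ-lead-acc : ∀ s γ i → w (γ +ᵉ lead i) < s →
                     φ (γ +ᵉ lead i) ≈ - eval (λ β → φ (γ +ᵉ β)) (tail i)
        φ-lead-acc (suc s) γ i (s≤s w≤s) with φ-split (γ +ᵉ lead i) (lead≰standard {γ} {i})
        ... | j , γ₁ , e , φ≈ with i Fin.≟ j
        ...   | yes ≡.refl = ≡.subst (λ γ → φ (γ +ᵉ lead i) ≈ - eval (λ β → φ (γ +ᵉ β)) (tail i))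
                    (+ᵉ-cancelˡ (lead i) (≡.trans (+ᵉ-comm (lead i) γ₁)
                      (≡.trans e (+ᵉ-comm γ (lead i)))))
                    (≡.subst (λ α → φ α ≈ _) (≡.sym e) φ≈)
        -- Adding lead i leaves entry j unchanged, so lead j already divides γ.
        ...   | no i≢j with subtract-single γ j dⱼ≤γⱼ
          where
          dⱼ≤γⱼ : d j ≤ lookup γ j
          dⱼ≤γⱼ = ℕ.≮⇒≥ λ γⱼ<dⱼ → ℕ.<⇒≱ γⱼ<dⱼ (≡.subst (d j ≤_)
                    (≡.trans (≡.cong (λ α → lookup α j) e) (lookup-+-single-≢ γ (toℕ i) (d i) j
                      (i≢j ∘ Fin.toℕ-injective))) (lookup-+-single-≥ γ₁ j (d j)))
        -- Reduce by j, then each lighter term by i; exchange the two evaluations and undo the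
        -- reductions by j. Both uses of the induction hypothesis concern exponents lighter than the
        -- given one.
        ...     | γ′ , ≡.refl = begin
          φ ((γ′ +ᵉ lead j) +ᵉ lead i)
            ≈⟨ φ≈ ⟩
          - eval (λ β → φ (γ₁ +ᵉ β)) (tail j)
            ≈⟨ -‿cong (eval-cong (tail j) (λ β → reflexive (≡.cong φ (≡.trans
                 (≡.cong (_+ᵉ β) γ₁≡) (+ᵉ-swapʳ γ′ (lead i) β))))) ⟩
          - eval (λ β → φ ((γ′ +ᵉ β) +ᵉ lead i)) (tail j)
            ≈⟨ -‿cong (eval-cong-All (All.map (λ {(_ , β)} w<w → φ-lead-acc s (γ′ +ᵉ β) i
                 (ℕ.<-≤-trans (≡.subst₂ _<_ (≡.cong w (+ᵉ-swapʳ γ′ (lead i) β))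
                   (≡.cong w (+ᵉ-swapʳ γ′ (lead i) (lead j))) w<w) w≤s))
                 (tail-shift (γ′ +ᵉ lead i) j))) ⟩
          - eval (λ β → - eval (λ β′ → φ ((γ′ +ᵉ β) +ᵉ β′)) (tail i)) (tail j)
            ≈⟨ -‿cong (eval-neg-functional _ (tail j)) ⟩
          - - eval (λ β → eval (λ β′ → φ ((γ′ +ᵉ β) +ᵉ β′)) (tail i)) (tail j)
            ≈⟨ -‿cong (-‿cong (eval-comm (λ β β′ → φ ((γ′ +ᵉ β) +ᵉ β′)) (tail j) (tail i))) ⟩
          - - eval (λ β′ → eval (λ β → φ ((γ′ +ᵉ β) +ᵉ β′)) (tail j)) (tail i)
            ≈⟨ -‿cong (eval-neg-functional _ (tail i)) ⟨
          - eval (λ β′ → - eval (λ β → φ ((γ′ +ᵉ β) +ᵉ β′)) (tail j)) (tail i)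
            ≈⟨ -‿cong (eval-cong (tail i) (λ β′ → -‿cong (eval-cong (tail j) (λ β →
                 reflexive (≡.cong φ (+ᵉ-swapʳ γ′ β β′)))))) ⟩
          - eval (λ β′ → - eval (λ β → φ ((γ′ +ᵉ β′) +ᵉ β)) (tail j)) (tail i)
            ≈⟨ -‿cong (eval-cong-All (All.map (λ {(_ , β′)} w<w → sym (φ-lead-acc s (γ′ +ᵉ β′) j
                 (ℕ.<-≤-trans (≡.subst (λ α → w α < _) (+ᵉ-swapʳ γ′ (lead j) β′) w<w) w≤s)))
                 (tail-shift (γ′ +ᵉ lead j) i))) ⟩
          - eval (λ β′ → φ ((γ′ +ᵉ β′) +ᵉ lead j)) (tail i)
            ≈⟨ -‿cong (eval-cong (tail i) (λ β′ → reflexive (≡.cong φ (+ᵉ-swapʳ γ′ β′ (lead j))))) ⟩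
          - eval (λ β′ → φ ((γ′ +ᵉ lead j) +ᵉ β′)) (tail i)
            ∎
          where
          γ₁≡ : γ₁ ≡ γ′ +ᵉ lead i
          γ₁≡ = +ᵉ-cancelˡ (lead j) (≡.trans (+ᵉ-comm (lead j) γ₁) (≡.trans e
                  (≡.trans (+ᵉ-swapʳ γ′ (lead j) (lead i)) (+ᵉ-comm (γ′ +ᵉ lead i) (lead j)))))

      φ-lead : ∀ γ i → φ (γ +ᵉ lead i) ≈ - eval (λ β → φ (γ +ᵉ β)) (tail i)
      φ-lead γ i = φ-lead-acc _ γ i (ℕ.n<1+n _)

      reducer∈annihilator : ∀ i → Ideal.Member (annihilator φ) (monomial (lead i) +ᴾ tail i)
      reducer∈annihilator i γ = begin
        eval (λ β → φ (γ +ᵉ β)) (monomial (lead i) +ᴾ tail i)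
          ≈⟨ eval-++ _ (monomial (lead i)) (tail i) ⟩
        eval (λ β → φ (γ +ᵉ β)) (monomial (lead i)) + eval (λ β → φ (γ +ᵉ β)) (tail i)
          ≈⟨ +-congʳ (trans (eval-monomial (λ β → φ (γ +ᵉ β)) (lead i)) (φ-lead γ i)) ⟩
        - eval (λ β → φ (γ +ᵉ β)) (tail i) + eval (λ β → φ (γ +ᵉ β)) (tail i)
          ≈⟨ -‿inverseˡ _ ⟩
        0# ∎

    -- The standard monomials form a basis of the quotient.

    module _ (J : Ideal polynomialRing (c ⊔ ℓ))
      (reducer∈J : ∀ i → Ideal.Member J (monomial (lead i) +ᴾ tail i))
      -- Takes the place of J being generated by the reducers, so that J may be presented by other
      -- generators.
      (J⊆annihilator : ∀ φ → (∀ i → Ideal.Member (annihilator φ) (monomial (lead i) +ᴾ tail i)) →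
                       ∀ {p} → Ideal.Member J p → Ideal.Member (annihilator φ) p)
      where
      open Quotient polynomialRing J
      open Ideal J

      StdIndex : Set
      StdIndex = [ α ∈ Vec ℕ k ∣ Standard α ]

      -- Combinations are lists of terms here, so that adding them is concatenation;
      -- `list-linearCombination` converts to indexed families.
      Span : Poly → Set _
      Span p = ∃[ u ] p ≈/ map (map₂ (value {P = Standard})) u

      Span-resp : ∀ {p q} → p ≈/ q → Span p → Span q
      Span-resp p≈q (u , e) = u , trans/ (sym/ p≈q) e

      Span-+ : ∀ {p q} → Span p → Span q → Span (p +ᴾ q)
      Span-+ (u , e) (v , e′) = u ++ v ,
        trans/ (+-cong/ e e′) (≈⇒≈/ (𝒫.reflexive (≡.sym (List.map-++ _ u v))))

      Span-* : ∀ r {p} → Span p → Span (constant r *ᴾ p)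
      Span-* r {p} (u , e) = map (λ (s , α) → r * s , α) u ,
        trans/ (*-congˡ/ (constant r) e) (≈⇒≈/ (≈-eval λ f →
          trans (eval-constant-* f r (map (map₂ value) u)) (scale f u)))
        where
        scale : ∀ f u → r * eval f (map (map₂ (value {P = Standard})) u) ≈
                eval f (map (map₂ value) (map (λ (s , α) → r * s , α) u))
        scale f []            = zeroʳ r
        scale f ((s , α) ∷ u) = trans (distribˡ r _ _) (+-cong (sym (*-assoc r s _)) (scale f u))

      Span-terms : ∀ {p} → All (λ (_ , α) → Span (monomial α)) p → Span p
      Span-terms []                        = [] , ≈⇒≈/ 𝒫.refl
      Span-terms {(r , α) ∷ p} (xα ∷ terms) = Span-resp
        (≈⇒≈/ (≈-eval λ f → trans (eval-++ f (constant r *ᴾ monomial α) p)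
          (+-congʳ (trans (eval-constant-* f r (monomial α)) (*-congˡ (eval-monomial f α))))))
        (Span-+ (Span-* r xα) (Span-terms terms))

      Span-monomial : ∀ s α → w α < s → Span (monomial α)
      Span-monomial (suc s) α (s≤s w≤s) with split α
      ... | inj₁ std = (1# , record { value = α ; proof = [ std ] }) ∷ [] , ≈⇒≈/ 𝒫.refl
      ... | inj₂ (i , γ , ≡.refl) = Span-resp
              -- Modulo J, x^(γ + lead i) equals - x^γ tail i, since the difference is - x^γ times a
              -- reducer.
              (congruent (resp eq (*-closed (constant (- 1#) *ᴾ monomial γ) (reducer∈J i))))
              -- The product `monomial γ *ᴾ tail i` unfolds to a mapped list followed by `++ []`,
              -- whence the final `[]`.
              (Span-* (- 1#) (Span-terms (All.++⁺ (All.map⁺ (All.map (λ w<w →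
                Span-monomial s _ (ℕ.<-≤-trans w<w w≤s)) (tail-shift γ i))) [])))
        where
        eq : constant (- 1#) *ᴾ monomial γ *ᴾ (monomial (lead i) +ᴾ tail i) ≈ᴾ
             constant (- 1#) *ᴾ (monomial γ *ᴾ tail i) +ᴾ -ᴾ monomial (γ +ᵉ lead i)
        eq = ≈-eval λ f → begin
          eval f (constant (- 1#) *ᴾ monomial γ *ᴾ (monomial (lead i) +ᴾ tail i))
            ≈⟨ eval-≈ f (𝒫.*-assoc (constant (- 1#)) (monomial γ) (monomial (lead i) +ᴾ tail i)) ⟩
          eval f (constant (- 1#) *ᴾ (monomial γ *ᴾ (monomial (lead i) +ᴾ tail i)))
            ≈⟨ eval-constant-* f (- 1#) (monomial γ *ᴾ (monomial (lead i) +ᴾ tail i)) ⟩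
          - 1# * eval f (monomial γ *ᴾ (monomial (lead i) +ᴾ tail i))
            ≈⟨ *-congˡ (trans (eval-monomial-* f γ (monomial (lead i) +ᴾ tail i))
                              (eval-++ _ (monomial (lead i)) (tail i))) ⟩
          - 1# * (eval (λ β → f (γ +ᵉ β)) (monomial (lead i)) + eval (λ β → f (γ +ᵉ β)) (tail i))
            ≈⟨ trans (*-congˡ (+-comm _ _)) (distribˡ _ _ _) ⟩
          - 1# * eval (λ β → f (γ +ᵉ β)) (tail i) + - 1# * eval (λ β → f (γ +ᵉ β)) (monomial (lead i))
            ≈⟨ +-cong (trans (eval-constant-* f (- 1#) (monomial γ *ᴾ tail i))
                             (*-congˡ (eval-monomial-* f γ (tail i))))
                 (trans (eval-neg f (monomial (γ +ᵉ lead i))) (trans (-‿cong (trans (eval-monomial f _)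
                   (sym (eval-monomial (λ β → f (γ +ᵉ β)) (lead i))))) (sym (-1*x≈-x _)))) ⟨
          eval f (constant (- 1#) *ᴾ (monomial γ *ᴾ tail i)) + eval f (-ᴾ monomial (γ +ᵉ lead i))
            ≈⟨ eval-++ f (constant (- 1#) *ᴾ (monomial γ *ᴾ tail i)) (-ᴾ monomial (γ +ᵉ lead i)) ⟨
          eval f (constant (- 1#) *ᴾ (monomial γ *ᴾ tail i) +ᴾ -ᴾ monomial (γ +ᵉ lead i)) ∎

      basisVector : StdIndex → Poly
      basisVector α = residueClass J (monomial (value α))

      eval-linearCombination : ∀ f {s} (r : Vector K s) (ι : Vector StdIndex s) →
        eval f (linearCombination (quotient J) r (basisVector ∘ ι)) ≈
        SemiringSum.sum semiring (λ j → r j * f (value (ι j)))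
      eval-linearCombination f {zero}  r ι = refl
      eval-linearCombination f {suc s} r ι = trans
        (eval-++ f (constant (r Fin.zero) *ᴾ monomial (value (ι Fin.zero)))
          (linearCombination (quotient J) (r ∘ Fin.suc) (basisVector ∘ ι ∘ Fin.suc)))
        (+-cong (trans (eval-constant-* f _ (monomial (value (ι Fin.zero)))) (*-congˡ (eval-monomial f _)))
                (eval-linearCombination f (r ∘ Fin.suc) (ι ∘ Fin.suc)))

      list-linearCombination : ∀ (u : List (K × StdIndex)) →
        map (map₂ value) u ≈ᴾ
        linearCombination (quotient J) (proj₁ ∘ List.lookup u) (basisVector ∘ proj₂ ∘ List.lookup u)
      list-linearCombination u = ≈-eval λ f → trans (terms f u) (sym (eval-linearCombination f
          (proj₁ ∘ List.lookup u) (proj₂ ∘ List.lookup u)))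
        where
        terms : ∀ f (u : List (K × StdIndex)) → eval f (map (map₂ value) u) ≈
                SemiringSum.sum semiring (λ j → proj₁ (List.lookup u j) * f (value (proj₂ (List.lookup u j))))
        terms f []      = refl
        terms f (_ ∷ u) = +-congˡ (terms f u)

      standardBasis : IsBasis (quotient J) {I = StdIndex} (λ α → residueClass J (monomial (value α)))
      standardBasis = record { spanning = spanning ; independent = independent }
        where
        spanning : ∀ p → ∃[ s ] Σ (Vector K s) λ r → Σ (Vector StdIndex s) λ ι →
                   p ≈/ linearCombination (quotient J) r (basisVector ∘ ι)
        spanning p with Span-terms {p} (All.universal (λ (_ , α) → Span-monomial _ α (ℕ.n<1+n (w α))) p)
        ... | u , e = length u , proj₁ ∘ List.lookup u , proj₂ ∘ List.lookup u ,
                      trans/ e (≈⇒≈/ (list-linearCombination u))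

        -- The indicator of the j-th exponent extends to a functional Φ that kills J; on the given
        -- combination Φ takes the value r j.
        independent : ∀ {s} (r : Vector K s) (ι : Vector StdIndex s) → Injective _≡_ _≡_ ι →
                      linearCombination (quotient J) r (basisVector ∘ ι) ≈/ 0ᴾ → ∀ j → r j ≈ 0#
        independent r ι ι-injective (congruent lc∈J) j = begin
          r j
            ≈⟨ trans (*-congˡ (reflexive (≡.trans (φ-at j) (δ-≡ {value (ι j)} ≡.refl)))) (*-identityʳ (r j)) ⟨
          r j * Φ (value (ι j))
            ≈⟨ sum-unique R (λ i → r i * Φ (value (ι i))) j (λ i i≢j → trans (*-congˡ (reflexive
                 (≡.trans (φ-at i) (δ-≢ {value (ι j)} (λ e → i≢j (ι-injective (value-injective e))))))) (zeroʳ (r i))) ⟨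
          SemiringSum.sum semiring (λ i → r i * Φ (value (ι i)))
            ≈⟨ eval-linearCombination Φ r ι ⟨
          eval Φ lc
            ≈⟨ +-identityʳ (eval Φ lc) ⟨
          eval Φ lc + 0#
            ≈⟨ eval-++ Φ lc (-ᴾ 0ᴾ) ⟨
          eval Φ (lc +ᴾ -ᴾ 0ᴾ)
            ≈⟨ eval-cong (lc +ᴾ -ᴾ 0ᴾ) (λ α → reflexive (≡.cong Φ (≡.sym (+ᵉ-identityˡ α)))) ⟩
          eval (λ β → Φ (0ᵉ +ᵉ β)) (lc +ᴾ -ᴾ 0ᴾ)
            -- The shift by 0 in the annihilator gives the vanishing of Φ itself.
            ≈⟨ J⊆annihilator Φ (reducer∈annihilator (δ (value (ι j)))) lc∈J 0ᵉ ⟩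
          0# ∎
          where
          lc : Poly
          lc = linearCombination (quotient J) r (basisVector ∘ ι)
          Φ : Exponent → K
          Φ = φ (δ (value (ι j)))
          standard : (α : StdIndex) → Standard (value α)
          standard record { value = α ; proof = [ std ] } i =
            -- The bound stored in an index is irrelevant; it is recovered because < is decidable.
            recompute (lookup α i ℕ.<? d i) (std i)
          φ-at : ∀ i → Φ (value (ι i)) ≡ δ (value (ι j)) (value (ι i))
          φ-at i = φ-standard (δ (value (ι j))) (standard (ι i))
          value-injective : ∀ {α β : StdIndex} → value α ≡ value β → α ≡ β
          value-injective ≡.refl = ≡.refl

  -- Top-degree coefficients of the generators.

  bit : Bool → K
  bit b = if b then 1# else 0#

  coeff-monomials-∉ : ∀ {L α} → All (α ≢_) L → coeff (map (1# ,_) L) α ≈ 0#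
  coeff-monomials-∉             []         = refl
  coeff-monomials-∉ {β ∷ _} {α} (α≢β ∷ α∉) with β ≟ α
  ... | yes β≡α = contradiction (≡.sym β≡α) α≢β
  ... | no _    = coeff-monomials-∉ α∉

  coeff-monomials-∈ : ∀ {L α} → Unique L → α ∈ L → coeff (map (1# ,_) L) α ≈ 1#
  coeff-monomials-∈ {β ∷ _} {α} (β∉ ∷ unique) α∈ with β ≟ α | α∈
  ... | yes ≡.refl | _         = trans (+-congˡ (coeff-monomials-∉ β∉)) (+-identityʳ 1#)
  ... | no β≢α     | here α≡β  = contradiction (≡.sym α≡β) β≢α
  ... | no _       | there α∈L = coeff-monomials-∈ unique α∈L

  coeff-h : ∀ m α → coeff (h m) α ≈ bit (occurs 0 m α)
  coeff-h m α with ∣ α ∣ ℕ.≟ m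
  ... | yes ≡.refl = trans
        (coeff-monomials-∈ (multiIndices-unique k ∣ α ∣) (∈-multiIndices⁺ α))
        -- `does (∣ α ∣ ℕ.≟ m)` is by definition the boolean `∣ α ∣ ≡ᵇ m` of `occurs 0 m α`.
        (reflexive (≡.sym (≡.cong bit (dec-true (∣ α ∣ ℕ.≟ ∣ α ∣) ≡.refl))))
  ... | no ∣α∣≢m = trans
        (coeff-monomials-∉ (All.¬Any⇒All¬ (multiIndices k m) (λ α∈ → ∣α∣≢m (∈-multiIndices⁻ m α∈))))
        (reflexive (≡.sym (≡.cong bit (dec-false (∣ α ∣ ℕ.≟ m) ∣α∣≢m))))

  -- p agrees with h_m(x_{i+1}, …, x_k) in degrees ≥ m.
  HasTop : ℕ → ℕ → Poly → Set _
  HasTop i m p = ∀ α → m ≤ ∣ α ∣ → coeff p α ≈ bit (occurs i m α)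

  hasTop-h : ∀ m a → deg a < m → HasTop 0 m (h m +ᴾ -ᴾ a)
  hasTop-h m a deg-a α m≤ = begin
    coeff (h m +ᴾ -ᴾ a) α               ≈⟨ coeff-+ (h m) (-ᴾ a) α ⟩
    coeff (h m) α + coeff (-ᴾ a) α      ≈⟨ +-cong (coeff-h m α) (coeff-neg a α) ⟩
    bit (occurs 0 m α) + - coeff a α    ≈⟨ +-congˡ (trans (-‿cong (deg-a α m≤)) -0#≈0#) ⟩
    bit (occurs 0 m α) + 0#             ≈⟨ +-identityʳ _ ⟩
    bit (occurs 0 m α)                  ∎

  -- h_m(x_{i+2}, …, x_k) = h_m(x_{i+1}, …, x_k) − x_{i+1} h_{m−1}(x_{i+1}, …, x_k)
  hasTop-suc : ∀ {i m p q} → i < k → HasTop i (suc m) p → HasTop i m q →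
               HasTop (suc i) (suc m) (p +ᴾ -ᴾ (monomial (single i 1) *ᴾ q))
  hasTop-suc {i} {m} {p} {q} i<k top-p top-q α m<∣α∣ = begin
    coeff (p +ᴾ -ᴾ x*q) α                  ≈⟨ coeff-+ p (-ᴾ x*q) α ⟩
    coeff p α + coeff (-ᴾ x*q) α           ≈⟨ +-cong (top-p α m<∣α∣) (coeff-neg x*q α) ⟩
    bit (occurs i (suc m) α) + - coeff x*q α ≈⟨ cancel (occurs-suc i<k α) ⟩
    bit (occurs (suc i) (suc m) α)         ∎
    where
    x*q = monomial (single i 1) *ᴾ q
    cancel : _ → bit (occurs i (suc m) α) + - coeff x*q α ≈ bit (occurs (suc i) (suc m) α)
    cancel (inj₁ (x∤α , same)) = begin
      bit (occurs i (suc m) α) + - coeff x*q α  ≈⟨ +-congˡ (trans (-‿cong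
                                                     (coeff-monomial-*-∤ _ q α x∤α)) -0#≈0#) ⟩
      bit (occurs i (suc m) α) + 0#             ≈⟨ +-identityʳ _ ⟩
      bit (occurs i (suc m) α)                  ≡⟨ ≡.cong bit (same (suc m)) ⟨
      bit (occurs (suc i) (suc m) α)            ∎
    cancel (inj₂ (β , ≡.refl , down , off)) = begin
      bit (occurs i (suc m) α) + - coeff x*q α  ≈⟨ +-cong (reflexive (≡.cong bit (down m)))
                                                     (-‿cong (trans (coeff-monomial-* (single i 1) q β)
                                                       (top-q β m≤∣β∣))) ⟩
      bit (occurs i m β) + - bit (occurs i m β) ≈⟨ -‿inverseʳ _ ⟩
      0#                                        ≡⟨ ≡.cong bit (off (suc m)) ⟨
      bit (occurs (suc i) (suc m) α)            ∎
      where
      m≤∣β∣ : m ≤ ∣ β ∣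
      m≤∣β∣ = ℕ.≤-pred (≡.subst (suc m ≤_) (≡.trans (∣+∣ (single i 1) β)
                (≡.cong (ℕ._+ ∣ β ∣) (∣single∣ i<k 1))) m<∣α∣)

  -- The triangular change of generators.

  module _ (g : ℕ → Poly) where

    -- A table whose row i = 0 holds the given generators and whose column t = 0 holds the new ones.
    -- Entry (i, t) involves only g t, ..., g (i + t).
    descent : ℕ → ℕ → Poly
    descent zero    t = g t
    descent (suc i) t = descent i (suc t) +ᴾ -ᴾ (monomial (single i 1) *ᴾ descent i t)

    hasTop-descent : ∀ N → (∀ t → HasTop 0 (N ℕ.+ suc t) (g t)) →
                     ∀ i t → i ≤ k → HasTop i (N ℕ.+ suc (i ℕ.+ t)) (descent i t)
    hasTop-descent N top zero    t _   = top t
    hasTop-descent N top (suc i) t i<k =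
      ≡.subst (λ m → HasTop (suc i) m (descent (suc i) t)) (≡.sym (ℕ.+-suc N (suc (i ℕ.+ t))))
        (hasTop-suc {p = descent i (suc t)} {q = descent i t} i<k
          (≡.subst (λ m → HasTop i m (descent i (suc t)))
            (≡.trans (≡.cong (λ s → N ℕ.+ suc s) (ℕ.+-suc i t)) (ℕ.+-suc N (suc (i ℕ.+ t))))
            (hasTop-descent N top i (suc t) (ℕ.<⇒≤ i<k)))
          (hasTop-descent N top i t (ℕ.<⇒≤ i<k)))

    module _ {p} (I : Ideal polynomialRing p) where
      open Ideal I

      descent∈ : (∀ t → t < k → Member (g t)) → ∀ i t → i ℕ.+ t < k → Member (descent i t)
      descent∈ g∈I zero    t t<k     = g∈I t t<k
      descent∈ g∈I (suc i) t 1+i+t<k = +-closed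
        (descent∈ g∈I i (suc t) (≡.subst (_< k) (≡.sym (ℕ.+-suc i t)) 1+i+t<k))
        (resp (𝒫.sym (RingProperties.-‿distribˡ-* 𝒫.ring (monomial (single i 1)) (descent i t)))
          (*-closed (-ᴾ monomial (single i 1)) (descent∈ g∈I i t (ℕ.<⇒≤ 1+i+t<k))))

      -- Solving the recursion for `descent i (suc t)` recovers column t + 1 from column t; row 0
      -- then returns the given generators.
      descent∈⁻¹ : (∀ i → i < k → Member (descent i 0)) → ∀ t i → i ℕ.+ t < k → Member (descent i t)
      descent∈⁻¹ f∈I zero    i i+0<k   = f∈I i (≡.subst (_< k) (ℕ.+-identityʳ i) i+0<k)
      descent∈⁻¹ f∈I (suc t) i i+1+t<k = resp
        (GroupProperties.//-rightDividesˡ 𝒫.+-group (monomial (single i 1) *ᴾ descent i t) (descent i (suc t)))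
        (+-closed (descent∈⁻¹ f∈I t (suc i) 1+i+t<k)
          (*-closed (monomial (single i 1)) (descent∈⁻¹ f∈I t i (ℕ.<⇒≤ 1+i+t<k))))
        where
        1+i+t<k : suc i ℕ.+ t < k
        1+i+t<k = ≡.subst (_< k) (ℕ.+-suc i t) i+1+t<k

  -- Leading monomials of the new generators.

  module _ {n : ℕ} where
    -- With C = kn, the condition km ≤ C of `∣∣<⇒weight<single` holds for all degrees m ≤ n.
    open Weight (k ℕ.* n)

    lighter? : ∀ (β : Exponent) → Decidable (λ (α : Exponent) → weight α < weight β)
    lighter? β α = weight α ℕ.<? weight β

    -- An exponent not lighter than that of x_{i+1}^m has degree at least m, so its coefficient is
    -- the one in h_m(x_{i+1}, ..., x_k), where only x_{i+1}^m is that heavy.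
    hasTop⇒lead+restrict : ∀ {i m p} → i < k → m ≤ n → HasTop i m p →
                           p ≈ᴾ monomial (single i m) +ᴾ restrict (lighter? (single i m)) p
    hasTop⇒lead+restrict {i} {m} {p} i<k m≤n top = coefficientwise λ α → sym (begin
      coeff (monomial σ +ᴾ restrict (lighter? σ) p) α            ≈⟨ coeff-+ (monomial σ) (restrict (lighter? σ) p) α ⟩
      coeff (monomial σ) α + coeff (restrict (lighter? σ) p) α   ≈⟨ +-congʳ (coeff-monomial σ α) ⟩
      δ α σ + coeff (restrict (lighter? σ) p) α                  ≈⟨ by-weight α ⟩
      coeff p α                                                  ∎)
      where
      σ = single i m
      by-weight : ∀ α → δ α σ + coeff (restrict (lighter? σ) p) α ≈ coeff p α
      by-weight α with weight α ℕ.<? weight σ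
      ... | yes α<σ = trans (+-cong (reflexive (δ-≢ {α} {σ} (λ σ≡α → ℕ.<-irrefl (≡.cong weight (≡.sym σ≡α)) α<σ)))
                                    (coeff-restrict-∈ (lighter? σ) p α<σ))
                            (+-identityˡ _)
      ... | no α≮σ  = begin
        δ α σ + coeff (restrict (lighter? σ) p) α  ≈⟨ +-congˡ (coeff-restrict-∉ (lighter? σ) p α≮σ) ⟩
        δ α σ + 0#                                 ≈⟨ +-identityʳ _ ⟩
        δ α σ                                      ≡⟨ δ≡bit ⟩
        bit (occurs i m α)                         ≈⟨ top α m≤∣α∣ ⟨
        coeff p α                                  ∎
        where
        m≤∣α∣ : m ≤ ∣ α ∣
        m≤∣α∣ = ℕ.≮⇒≥ (α≮σ ∘ ∣∣<⇒weight<single i<k (ℕ.*-monoʳ-≤ k m≤n) α)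
        δ≡bit : δ α σ ≡ bit (occurs i m α)
        δ≡bit with occurs i m α in occ
        ... | true  = δ-≡ {α} {σ} (≡.sym (occurs-heavy⇒single i<k m α occ (ℕ.≮⇒≥ α≮σ)))
        ... | false = δ-≢ {α} {σ} λ { ≡.refl → contradiction (≡.trans (≡.sym (occurs-single i<k m)) occ) λ () }

-- Assembling the basis theorem.

open import Data.Nat.Base using (_+_; _*_)

theorem2p2 : ∀ {c ℓ} (R : CommutativeRing c ℓ) (k n : ℕ) → k ≤ n →
    let open Polynomial R k in
    (a : Vector Poly k) →
    (∀ i → deg a i < n ∸ k + suc (toℕ i)) →
    let J = generatedIdeal polynomialRing (λ i → h (n ∸ k + suc (toℕ i)) +ᴾ -ᴾ a i)
    in
    IsBasis (quotient J)
    {I = [ α ∈ Vec ℕ k ∣ (∀ (i : Fin k) → lookup α i < n ∸ k + suc (toℕ i)) ]}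
    (λ α → residueClass J (monomial (value α)))
theorem2p2 R k n k≤n a deg-a =
  -- An annihilator containing the f_i contains the given generators, by inverting the change of
  -- generators, and hence J.
  basis _ f∈J (λ φ f∈ → generatedIdeal⊆ (annihilator R k φ) generator (generator∈annihilator φ f∈))
  where
  open Polynomial R k
  module 𝒫 = CommutativeRing polynomialRing
  open Weight (k * n)

  d : Fin k → ℕ
  d i = n ∸ k + suc (toℕ i)

  generator : Vector Poly k
  generator i = h (d i) +ᴾ -ᴾ a i

  J = generatedIdeal polynomialRing generator
  open Ideal J using (resp)

  d≤n : ∀ i → d i ≤ n
  d≤n i = ℕ.≤-trans (ℕ.+-monoʳ-≤ (n ∸ k) (Fin.toℕ<n i)) (ℕ.≤-reflexive (ℕ.m∸n+n≡m k≤n))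

  -- Extending the family by 0 beyond k preserves the degree bounds and lets `descent` increase t
  -- freely.
  a′ : ℕ → Poly
  a′ t with t ℕ.<? k
  ... | yes t<k = a (Fin.fromℕ< t<k)
  ... | no _    = 0ᴾ

  deg-a′ : ∀ t → deg a′ t < n ∸ k + suc t
  deg-a′ t with t ℕ.<? k
  ... | yes t<k = ≡.subst (λ s → deg a (Fin.fromℕ< t<k) < n ∸ k + suc s) (Fin.toℕ-fromℕ< t<k)
                          (deg-a (Fin.fromℕ< t<k))
  ... | no _    = λ _ _ → CommutativeRing.refl R

  a′-toℕ : ∀ i → a′ (toℕ i) ≡ a i
  a′-toℕ i with toℕ i ℕ.<? k
  ... | yes i<k = ≡.cong a (Fin.fromℕ<-toℕ i i<k)
  ... | no i≮k  = contradiction (Fin.toℕ<n i) i≮k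

  g : ℕ → Poly
  g t = h (n ∸ k + suc t) +ᴾ -ᴾ a′ t

  g-toℕ : ∀ i → g (toℕ i) ≡ generator i
  g-toℕ i = ≡.cong (λ b → h (d i) +ᴾ -ᴾ b) (a′-toℕ i)

  g∈J : ∀ t → t < k → Ideal.Member J (g t)
  g∈J t t<k = ≡.subst (Ideal.Member J ∘ g) (Fin.toℕ-fromℕ< t<k)
    (≡.subst (Ideal.Member J) (≡.sym (g-toℕ (Fin.fromℕ< t<k)))
      (generator∈ polynomialRing generator (Fin.fromℕ< t<k)))

  tail : Fin k → Poly
  tail i = restrict R k (lighter? R k {n} (single (toℕ i) (d i))) (descent R k g (toℕ i) 0)

  f : Fin k → Poly
  f i = monomial (single (toℕ i) (d i)) +ᴾ tail i

  descent≈f : ∀ i → descent R k g (toℕ i) 0 ≈ᴾ f i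
  descent≈f i = hasTop⇒lead+restrict R k (Fin.toℕ<n i) (d≤n i)
    (≡.subst (λ m → HasTop R k (toℕ i) m (descent R k g (toℕ i) 0))
      (≡.cong (λ s → n ∸ k + suc s) (ℕ.+-identityʳ (toℕ i)))
      (hasTop-descent R k g (n ∸ k) (λ t → hasTop-h R k (n ∸ k + suc t) (a′ t) (deg-a′ t))
        (toℕ i) 0 (ℕ.<⇒≤ (Fin.toℕ<n i))))

  f∈J : ∀ i → Ideal.Member J (f i)
  f∈J i = resp {descent R k g (toℕ i) 0} {f i} (descent≈f i)
    (descent∈ R k g J g∈J (toℕ i) 0 (≡.subst (_< k) (≡.sym (ℕ.+-identityʳ (toℕ i))) (Fin.toℕ<n i)))

  generator∈annihilator : ∀ φ → (∀ i → Ideal.Member (annihilator R k φ) (f i)) →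
                          ∀ i → Ideal.Member (annihilator R k φ) (generator i)
  generator∈annihilator φ f∈ i =
    ≡.subst I.Member {g (toℕ i)} {generator i} (g-toℕ i)
      (descent∈⁻¹ R k g (annihilator R k φ) descent∈I (toℕ i) 0 (Fin.toℕ<n i))
    where
    module I = Ideal (annihilator R k φ)
    descent∈I : ∀ j → j < k → I.Member (descent R k g j 0)
    descent∈I j j<k = ≡.subst (λ j → I.Member (descent R k g j 0)) (Fin.toℕ-fromℕ< j<k)
      (I.resp {f i′} {descent R k g (toℕ i′) 0} (𝒫.sym (descent≈f i′)) (f∈ i′))
      where i′ = Fin.fromℕ< j<k

  open Reduction R k weight weight-+ d tail
    (λ i → All.all-filter (lighter? R k {n} (single (toℕ i) (d i)) ∘ proj₂) (descent R k g (toℕ i) 0))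

  basis : ∀ J → (∀ i → Ideal.Member J (f i)) →
          (∀ φ → (∀ i → Ideal.Member (annihilator R k φ) (f i)) →
           ∀ {p} → Ideal.Member J p → Ideal.Member (annihilator R k φ) p) →
          IsBasis (quotient J)
            {I = [ α ∈ Vec ℕ k ∣ (∀ (i : Fin k) → lookup α i < n ∸ k + suc (toℕ i)) ]}
            (λ α → residueClass J (monomial (value α)))
  basis J = standardBasis J
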